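{- Let $n\in\mathbb{N}$ and $T\in\operatorname{YT}(n)$. If $n\ge 8$, then $\operatorname{M}_2(T)$ determines $T$; that is, for $S,T\in\operatorname{YT}(n)$ with $n\ge 8$, $\operatorname{M}_2(S)=\operatorname{M}_2(T)$ implies $S=T$.
   Context: $\mathbb{N}=\{1,2,\dots\}$. A (standard Young) tableau of shape $\lambda$ (a partition of $n$) is a filling of the Young diagram of $\lambda$ by distinct elements of $[1,n]$ increasing strictly along rows and down columns; $\operatorname{YT}(n)$ is the set of such tableaux with entries exactly $[1,n]$. Deletion by jeu de taquin: for $T\in\operatorname{YT}(n)$ and an entry $m$, delete the cell containing $m$; repeatedly, if there is a cell directly to the right of or directly below the empty space, slide the one with the smaller entry into it; stop when neither exists; then subtract 1 from every entry larger than $m$, giving $T-m\in\operatorname{YT}(n-1)$. A $2$-minor of $T$ is a tableau obtained by two successive such deletions; $\operatorname{M}_2(T)$ is the set of all $2$-minors of $T$. -}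

module Defs where

open import Data.Nat using (ℕ; zero; suc; _+_; _∸_; _<_; _≤_; _<ᵇ_)
open import Data.Bool using (Bool; true; false; if_then_else_)
open import Data.List using (List; []; _∷_; concat; map; upTo; length)
open import Data.Nat.ListAction using (sum)
open import Data.List.Relation.Binary.Permutation.Propositional using (_↭_)
open import Data.Maybe using (Maybe; just; nothing)
open import Data.Product using (_×_; _,_; ∃-syntax)
open import Data.Unit using (⊤)
open import Data.Empty using (⊥)
open import Relation.Binary.PropositionalEquality using (_≡_)

-- Tableaux are represented as lists of rows (top row first), each row a
-- list of entries (left to right).

Tableau : Set
Tableau = List (List ℕ)

RowInc : List ℕ → Set
RowInc []           = ⊤
RowInc (x ∷ [])     = ⊤
RowInc (x ∷ y ∷ xs) = x < y × RowInc (y ∷ xs)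

ColInc : List ℕ → List ℕ → Set
ColInc _        []       = ⊤
ColInc []       (_ ∷ _)  = ⊥
ColInc (x ∷ xs) (y ∷ ys) = x < y × ColInc xs ys

NonEmpty : List ℕ → Set
NonEmpty []      = ⊥
NonEmpty (_ ∷ _) = ⊤

-- Consecutive rows satisfy ColInc (which also forces the row lengths to be
-- weakly decreasing, i.e. the shape is a Young diagram of a partition).
ColsInc : Tableau → Set
ColsInc []            = ⊤
ColsInc (r ∷ [])      = ⊤
ColsInc (r ∷ s ∷ rs)  = ColInc r s × ColsInc (s ∷ rs)

AllRows : (List ℕ → Set) → Tableau → Set
AllRows P []       = ⊤
AllRows P (r ∷ rs) = P r × AllRows P rs

YT : ℕ → Tableau → Set
YT n T = AllRows NonEmpty T × AllRows RowInc T × ColsInc T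
       × (concat T ↭ map suc (upTo n))

at : List ℕ → ℕ → Maybe ℕ
at []       _       = nothing
at (x ∷ xs) zero    = just x
at (x ∷ xs) (suc j) = at xs j

at2 : Tableau → ℕ → ℕ → Maybe ℕ
at2 []       _       j = nothing
at2 (r ∷ rs) zero    j = at r j
at2 (r ∷ rs) (suc i) j = at2 rs i j

setAt : List ℕ → ℕ → ℕ → List ℕ
setAt []       _       v = []
setAt (x ∷ xs) zero    v = v ∷ xs
setAt (x ∷ xs) (suc j) v = x ∷ setAt xs j v

set2 : Tableau → ℕ → ℕ → ℕ → Tableau
set2 []       _       j v = []
set2 (r ∷ rs) zero    j v = setAt r j v ∷ rs
set2 (r ∷ rs) (suc i) j v = r ∷ set2 rs i j v

removeAt : List ℕ → ℕ → List ℕ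
removeAt []       _       = []
removeAt (x ∷ xs) zero    = xs
removeAt (x ∷ xs) (suc j) = x ∷ removeAt xs j

remove2 : Tableau → ℕ → ℕ → Tableau
remove2 []       _       j = []
remove2 (r ∷ rs) zero    j with removeAt r j
... | []      = rs
... | r′@(_ ∷ _) = r′ ∷ rs
remove2 (r ∷ rs) (suc i) j = r ∷ remove2 rs i j

_==_ : ℕ → ℕ → Bool
zero  == zero  = true
zero  == suc _ = false
suc _ == zero  = false
suc m == suc n = m == n

findRow : ℕ → List ℕ → Maybe ℕ
findRow m []       = nothing
findRow m (x ∷ xs) with m == x
... | true  = just zero
... | false with findRow m xs
...   | just j  = just (suc j)
...   | nothing = nothing

find2 : ℕ → Tableau → Maybe (ℕ × ℕ)
find2 m []       = nothing
find2 m (r ∷ rs) with findRow m r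
... | just j  = just (zero , j)
... | nothing with find2 m rs
...   | just (i , j) = just (suc i , j)
...   | nothing      = nothing

-- Slide the empty space at (i,j) outwards.  The contents of the empty
-- cell are irrelevant.  Each step increases i + j, so a fuel equal to the
-- number of cells (plus one) is always sufficient.
slide : ℕ → Tableau → ℕ → ℕ → Tableau
slide zero       T i j = remove2 T i j
slide (suc fuel) T i j with at2 T i (suc j) | at2 T (suc i) j
... | nothing | nothing = remove2 T i j
... | just r  | nothing = slide fuel (set2 T i j r) i (suc j)
... | nothing | just b  = slide fuel (set2 T i j b) (suc i) j
... | just r  | just b  = if r <ᵇ b
                            then slide fuel (set2 T i j r) i (suc j)
                            else slide fuel (set2 T i j b) (suc i) j

decr : ℕ → ℕ → ℕ
decr m x = if m <ᵇ x then x ∸ 1 else x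

size : Tableau → ℕ
size T = sum (map length T)

del : Tableau → ℕ → Tableau
del T m with find2 m T
... | nothing      = T
... | just (i , j) = map (map (decr m)) (slide (suc (size T)) T i j)

M₂ : ℕ → Tableau → Tableau → Set
M₂ n T U = ∃[ a ] ∃[ b ] (1 ≤ a × a ≤ n × 1 ≤ b × b ≤ n ∸ 1
                         × U ≡ del (del T a) b)

{-# OPTIONS --safe #-}
module Submission where

open import Defs
open import Data.Bool using (true; false; if_then_else_)
open import Data.Empty using (⊥)
open import Data.List
  using (List; []; _∷_; _∷ʳ_; concat; concatMap; cartesianProductWith; filter; length; map; upTo)
open import Data.List.Membership.Propositional using (_∈_; find; lose)
open import Data.List.Membership.Propositional.Properties
  using (∈-++⁻; ∈-map⁺; ∈-map⁻; ∈-upTo⁺; ∈-upTo⁻; ∈-concatMap⁺; ∈-concatMap⁻; ∈-filter⁺; ∈-cartesianProductWith⁺)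
open import Data.List.Properties using (≡-dec; ++-assoc; length-++; map-++; upTo-∷ʳ)
open import Data.List.Relation.Binary.Permutation.Propositional as ↭
  using (_↭_; ↭-refl; ↭-reflexive; ↭-sym; ↭-trans; prep; swap)
open import Data.List.Relation.Binary.Permutation.Propositional.Properties
  using (All-resp-↭; ∈-resp-↭; drop-∷; shift; ++⁺ˡ; ↭-empty-inv; ↭-length; ∷↭∷ʳ)
open import Data.List.Relation.Binary.Subset.Propositional using (_⊆_)
open import Data.List.Relation.Unary.All as All using (All; []; _∷_; all?)
import Data.List.Relation.Unary.All.Properties as All
open import Data.List.Relation.Unary.Any using (here; there)
open import Data.Maybe using (just; nothing)
open import Data.Maybe.Properties using (just-injective)
open import Data.Nat
open import Data.Nat.Properties
open import Data.Nat.Tactic.RingSolver using (solve-∀)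
open import Data.Product using (_×_; _,_; proj₁; proj₂; ∃-syntax)
open import Data.Sum using (_⊎_; inj₁; inj₂)
open import Data.Unit using (⊤; tt)
open import Function using (_∘_)
open import Function.Bundles using (_⇔_; Equivalence)
open import Relation.Binary using (tri<; tri≈; tri>)
open import Relation.Binary.PropositionalEquality
open import Relation.Nullary using (Dec; yes; no; does; ¬_; contradiction)
open import Relation.Nullary.Decidable using (_×-dec_; _⊎-dec_; dec-true; dec-false)

-- A tableau is encoded by the word of the row indices of its entries, the row of the
-- largest entry first. Jeu de taquin is then a local rule: when the slide in the tableau
-- without its maximum vacates the end of row r, the maximum in row i moves only if its
-- cell is next to the vacated one, and then it vacates its own cell. In particular,
-- deletion commutes with forgetting the maximum, so the 2-minors of T determine the
-- 2-minors of T without its maximum, and by induction T without its maximum.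
-- It remains to locate the maximum. Suppose a shape μ admits new cells c and d, in rows
-- i < j. If at least two cells of μ lie outside the rectangle with opposite corners
-- (0,0) and c, two of them can be removed one after the other without moving the maximum
-- at c, and this 2-minor contains c, which no 2-minor of μ ∪ {d} does. Likewise for d;
-- both conditions can fail only if |μ| ≤ 6.
-- The induction starts at n = 8 with an exhaustive search.

-- Words of row indices and the local deletion rule

Word : Set
Word = List ℕ

_≟ʷ_ : (v w : Word) → Dec (v ≡ w)
_≟ʷ_ = ≡-dec _≟_

open import Data.List.Relation.Binary.Subset.DecPropositional _≟ʷ_ using (_⊆?_)

count : Word → ℕ → ℕ
count []      x = 0
count (i ∷ w) x = if does (i ≟ x) then suc (count w x) else count w x

-- The next cell of row i lies directly below the last cell of row r. If r = i, the maximum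
-- also moves, but within its row, so that push treats this like the case of no move.
Bump : Word → ℕ → ℕ → Set
Bump w i r = suc r ≡ i × count w r ≡ suc (count w i)

bump? : ∀ w i r → Dec (Bump w i r)
bump? w i r = suc r ≟ i ×-dec count w r ≟ suc (count w i)

-- In the pair, `v` is the word left by the deletion and `r` the row whose last cell it vacates. A
-- bump lifts the maximum into that cell, so that row `i` is vacated instead.
push : Word → ℕ → Word × ℕ → Word × ℕ
push w i (v , r) = if does (bump? w i r) then (r ∷ v , i) else (i ∷ v , r)

-- Positions count down from the maximum: `k` stands for the entry `length w ∸ k`. The value on the
-- empty word is a default, kept away by `k < length w`.
delete : Word → ℕ → Word × ℕ
delete []      k       = [] , 0
delete (i ∷ w) zero    = w , i
delete (i ∷ w) (suc k) = push w i (delete w k)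

minors : Word → List Word
minors w = map (proj₁ ∘ delete w) (upTo (length w))

minors₂ : Word → List Word
minors₂ = concatMap minors ∘ minors

Addable : (ℕ → ℕ) → ℕ → Set
Addable f zero    = ⊤
Addable f (suc i) = f (suc i) < f i

addable? : ∀ f i → Dec (Addable f i)
addable? f zero    = yes tt
addable? f (suc i) = f (suc i) <? f i

Young : (ℕ → ℕ) → Set
Young f = ∀ x → f (suc x) ≤ f x

young⇒antitone : ∀ {f} → Young f → ∀ {x y} → x ≤ y → f y ≤ f x
young⇒antitone {f} yng {x} x≤y = go (≤⇒≤′ x≤y)
  where
  go : ∀ {y} → x ≤′ y → f y ≤ f x
  go (≤′-reflexive refl) = ≤-refl
  go (≤′-step x≤y) = ≤-trans (yng _) (go x≤y)

-- Read from its last letter, such a word is a lattice (Yamanouchi) word; these are the words of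
-- standard tableaux.
Lattice : Word → Set
Lattice []      = ⊤
Lattice (i ∷ w) = Addable (count w) i × Lattice w

count-≡ : ∀ i w → count (i ∷ w) i ≡ suc (count w i)
count-≡ i w rewrite dec-true (i ≟ i) refl = refl

count-≢ : ∀ {i x} w → i ≢ x → count (i ∷ w) x ≡ count w x
count-≢ {i} {x} w i≢x rewrite dec-false (i ≟ x) i≢x = refl

count-∷-cong : ∀ i {v w} x → count v x ≡ count w x → count (i ∷ v) x ≡ count (i ∷ w) x
count-∷-cong i x eq rewrite eq = refl

count-≤-∷ : ∀ i w x → count w x ≤ count (i ∷ w) x
count-≤-∷ i w x with i ≟ x
... | yes refl = ≤-trans (n≤1+n _) (≤-reflexive (sym (count-≡ i w)))
... | no i≢x   = ≤-reflexive (sym (count-≢ w i≢x))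

count-↭ : ∀ {v w} → v ↭ w → ∀ x → count v x ≡ count w x
count-↭ ↭.refl x = refl
count-↭ (prep {v} {w} i p) x = count-∷-cong i {v} {w} x (count-↭ p x)
count-↭ (↭.trans p q) x = trans (count-↭ p x) (count-↭ q x)
count-↭ (swap i j p) x rewrite count-↭ p x with does (i ≟ x) | does (j ≟ x)
... | true  | true  = refl
... | true  | false = refl
... | false | true  = refl
... | false | false = refl

push-bump : ∀ w {i v r} → Bump w i r → push w i (v , r) ≡ (r ∷ v , i)
push-bump w {i} {v} {r} b rewrite dec-true (bump? w i r) b = refl

push-no-bump : ∀ w {i v r} → ¬ Bump w i r → push w i (v , r) ≡ (i ∷ v , r)
push-no-bump w {i} {v} {r} b rewrite dec-false (bump? w i r) b = refl

-- This is why deletion commutes with forgetting the maximum: `push` chooses a head letter and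
-- leaves the tail alone.
push-tail : ∀ w i p → ∃[ z ] proj₁ (push w i p) ≡ z ∷ proj₁ p
push-tail w i (v , r) with bump? w i r
... | yes b = r , cong proj₁ (push-bump w b)
... | no ¬b = i , cong proj₁ (push-no-bump w ¬b)

-- Of the two cells at the ends of rows `i` and `r`, one receives the maximum and the other is
-- vacated, in either case.
push-↭ : ∀ w i v r → proj₂ (push w i (v , r)) ∷ proj₁ (push w i (v , r)) ↭ i ∷ r ∷ v
push-↭ w i v r with bump? w i r
... | yes b rewrite push-bump w {v = v} b = ↭-refl
... | no ¬b rewrite push-no-bump w {v = v} ¬b = swap r i ↭-refl

delete-↭ : ∀ w {k} → k < length w → proj₂ (delete w k) ∷ proj₁ (delete w k) ↭ w
delete-↭ (i ∷ w) {zero}  k< = ↭-refl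
delete-↭ (i ∷ w) {suc k} k< =
  ↭-trans (push-↭ w i (proj₁ (delete w k)) (proj₂ (delete w k))) (prep i (delete-↭ w (s≤s⁻¹ k<)))

delete-length : ∀ w {k} → k < length w → suc (length (proj₁ (delete w k))) ≡ length w
delete-length w k< = ↭-length (delete-↭ w k<)

lattice⇒young : ∀ w → Lattice w → Young (count w)
lattice⇒young []      _            x = z≤n
lattice⇒young (i ∷ w) (add , lat) x with i ≟ suc x
... | yes refl = begin
  count (suc x ∷ w) (suc x) ≡⟨ count-≡ (suc x) w ⟩
  suc (count w (suc x))     ≤⟨ add ⟩
  count w x                 ≤⟨ count-≤-∷ (suc x) w x ⟩
  count (suc x ∷ w) x       ∎
  where open ≤-Reasoning
... | no i≢    = begin
  count (i ∷ w) (suc x) ≡⟨ count-≢ w i≢ ⟩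
  count w (suc x)       ≤⟨ lattice⇒young w lat x ⟩
  count w x             ≤⟨ count-≤-∷ i w x ⟩
  count (i ∷ w) x       ∎
  where open ≤-Reasoning

-- The equation says that `w` has the shape of `v` and one more cell in row `r`. A bump refills that
-- cell. Otherwise only a maximum in the row directly below `r` could lose its support, and `¬ Bump`
-- leaves it a cell to spare.
push-lattice : ∀ w i v r → (∀ x → count w x ≡ count (r ∷ v) x) →
               Lattice (i ∷ w) → Lattice v → Lattice (proj₁ (push w i (v , r)))
push-lattice w i v r w≡rv (add , latw) latv with bump? w i r
... | yes b@(refl , eq) rewrite push-bump w {v = v} b = bumped r eq w≡rv , latv
  where
  bumped : ∀ r → count w r ≡ suc (count w (suc r)) → (∀ x → count w x ≡ count (r ∷ v) x) → Addable (count v) r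
  bumped zero    _  _ = tt
  bumped (suc p) eq w≡ = begin-strict
    count v (suc p) <⟨ ≤-reflexive (sym (trans (w≡ (suc p)) (count-≡ (suc p) v))) ⟩
    count w (suc p) ≤⟨ lattice⇒young w latw p ⟩
    count w p       ≡⟨ trans (w≡ p) (count-≢ v 1+n≢n) ⟩
    count v p       ∎
    where open ≤-Reasoning
... | no ¬b rewrite push-no-bump w {v = v} ¬b = kept i add ¬b , latv
  where
  kept : ∀ i → Addable (count w) i → ¬ Bump w i r → Addable (count v) i
  kept zero    _   _  = tt
  kept (suc p) add ¬b with r ≟ p
  ... | yes refl = s≤s⁻¹ (begin-strict
    suc (count v (suc r)) ≡⟨ cong suc (sym (trans (w≡rv (suc r)) (count-≢ v (1+n≢n ∘ sym)))) ⟩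
    suc (count w (suc r)) <⟨ ≤∧≢⇒< add (λ eq → ¬b (refl , sym eq)) ⟩
    count w r             ≡⟨ trans (w≡rv r) (count-≡ r v) ⟩
    suc (count v r)       ∎)
    where open ≤-Reasoning
  ... | no r≢p = begin-strict
    count v (suc p)       ≤⟨ count-≤-∷ r v (suc p) ⟩
    count (r ∷ v) (suc p) ≡⟨ sym (w≡rv (suc p)) ⟩
    count w (suc p)       <⟨ add ⟩
    count w p             ≡⟨ trans (w≡rv p) (count-≢ v r≢p) ⟩
    count v p             ∎
    where open ≤-Reasoning

delete-lattice : ∀ w {k} → Lattice w → k < length w → Lattice (proj₁ (delete w k))
delete-lattice (i ∷ w) {zero}  (_ , lat) k< = lat
delete-lattice (i ∷ w) {suc k} lat@(_ , latw) (s≤s k<) =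
  push-lattice w i _ _ (λ x → sym (count-↭ (delete-↭ w k<) x)) lat (delete-lattice w latw k<)

-- Minors

∈-minors⁺ : ∀ w {k} → k < length w → proj₁ (delete w k) ∈ minors w
∈-minors⁺ w k< = ∈-map⁺ (proj₁ ∘ delete w) (∈-upTo⁺ k<)

∈-minors⁻ : ∀ w {v} → v ∈ minors w → ∃[ k ] (k < length w × v ≡ proj₁ (delete w k))
∈-minors⁻ w v∈ with k , k∈ , eq ← ∈-map⁻ (proj₁ ∘ delete w) v∈ = k , ∈-upTo⁻ k∈ , eq

∈-minors₂⁺ : ∀ w {u v} → v ∈ minors w → u ∈ minors v → u ∈ minors₂ w
∈-minors₂⁺ w v∈ u∈ = ∈-concatMap⁺ minors (lose v∈ u∈)

∈-minors₂⁻ : ∀ w {u} → u ∈ minors₂ w → ∃[ v ] (v ∈ minors w × u ∈ minors v)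
∈-minors₂⁻ w u∈ = find (∈-concatMap⁻ minors {xs = minors w} u∈)

tail∈minors : ∀ i w → w ∈ minors (i ∷ w)
tail∈minors i w = ∈-minors⁺ (i ∷ w) {0} z<s

∷-∈-minors : ∀ i w {v} → v ∈ minors w → ∃[ z ] z ∷ v ∈ minors (i ∷ w)
∷-∈-minors i w v∈
  with k , k< , refl ← ∈-minors⁻ w v∈
  with z , eq ← push-tail w i (delete w k) =
  z , subst (_∈ minors (i ∷ w)) eq (∈-minors⁺ (i ∷ w) {suc k} (s<s k<))

minors-∷⁻ : ∀ i w {y} → y ∈ minors (i ∷ w) → y ≡ w ⊎ ∃[ z ] ∃[ v ] (v ∈ minors w × y ≡ z ∷ v)
minors-∷⁻ i w y∈ with ∈-minors⁻ (i ∷ w) y∈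
... | zero  , _      , refl = inj₁ refl
... | suc k , s≤s k< , refl with z , eq ← push-tail w i (delete w k) =
  inj₂ (z , proj₁ (delete w k) , ∈-minors⁺ w k< , eq)

-- Forgetting the maximum is itself a deletion, so the tail of a minor is reached by two deletions.
minor-tail : ∀ t {x u} → x ∷ u ∈ minors t → u ∈ minors₂ t
minor-tail (j ∷ t) x∷u∈ with minors-∷⁻ j t x∷u∈
... | inj₁ refl                 = ∈-minors₂⁺ (j ∷ t) (tail∈minors j t) (tail∈minors _ _)
... | inj₂ (z , v , v∈ , refl) = ∈-minors₂⁺ (j ∷ t) (tail∈minors j t) v∈

_⊑_ : Word → Word → Set
v ⊑ w = ∀ u → u ∈ minors₂ v → u ∈ minors₂ w

-- Deleting the same two entries lifts `u` to a 2-minor `x ∷ u` of `i ∷ s`, hence of `j ∷ t`. If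
-- neither deletion there takes the maximum, the tails form a chain of minors from `t` to `u`. If
-- one does, `x ∷ u` is a minor of `t` and `minor-tail` applies.
⊑-restrict : ∀ i s j t → (i ∷ s) ⊑ (j ∷ t) → s ⊑ t
⊑-restrict i s j t sub u u∈
  with v , v∈ , u∈v ← ∈-minors₂⁻ s u∈
  with z , zv∈ ← ∷-∈-minors i s v∈
  with x , xu∈ ← ∷-∈-minors z v u∈v
  with y , y∈ , xu∈y ← ∈-minors₂⁻ (j ∷ t) (sub _ (∈-minors₂⁺ (i ∷ s) zv∈ xu∈))
  with minors-∷⁻ j t y∈
... | inj₁ refl = minor-tail t xu∈y
... | inj₂ (z′ , v′ , v′∈ , refl) with minors-∷⁻ z′ v′ xu∈y
...   | inj₁ refl = minor-tail t v′∈
...   | inj₂ (_ , u′ , u′∈ , refl) = ∈-minors₂⁺ t v′∈ u′∈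

-- Counting cells by rows

total : (ℕ → ℕ) → ℕ → ℕ
total f zero    = 0
total f (suc L) = f L + total f L

total-count-< : ∀ i w L → i < L → total (count (i ∷ w)) L ≡ suc (total (count w) L)
total-count-≥ : ∀ i w L → L ≤ i → total (count (i ∷ w)) L ≡ total (count w) L
total-count-≥ i w zero    L≤i = refl
total-count-≥ i w (suc L) L<i =
  cong₂ _+_ (count-≢ w (<⇒≢ L<i ∘ sym)) (total-count-≥ i w L (<⇒≤ L<i))
total-count-< i w (suc L) i<sL with i ≟ L
... | yes refl = cong₂ _+_ (count-≡ i w) (total-count-≥ i w i ≤-refl)
... | no i≢L   = trans
  (cong₂ _+_ (count-≢ w i≢L) (total-count-< i w L (≤∧≢⇒< (s≤s⁻¹ i<sL) i≢L)))
  (+-suc _ _)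

total-zero : ∀ L → total (count []) L ≡ 0
total-zero zero    = refl
total-zero (suc L) = total-zero L

total-count≤length : ∀ w L → total (count w) L ≤ length w
total-count≤length []      L = ≤-reflexive (total-zero L)
total-count≤length (i ∷ w) L with i <? L
... | yes i<L = ≤-trans (≤-reflexive (total-count-< i w L i<L)) (s≤s (total-count≤length w L))
... | no i≮L  = ≤-trans (≤-reflexive (total-count-≥ i w L (≮⇒≥ i≮L))) (m≤n⇒m≤1+n (total-count≤length w L))

length≤total-count : ∀ w L → (∀ {x} → L ≤ x → count w x ≡ 0) → length w ≤ total (count w) L
length≤total-count []      L _ = z≤n
length≤total-count (i ∷ w) L vanishes with i <? L
... | yes i<L = ≤-trans
  (s≤s (length≤total-count w L λ {x} L≤x → n≤0⇒n≡0 (≤-trans (count-≤-∷ i w x) (≤-reflexive (vanishes L≤x)))))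
  (≤-reflexive (sym (total-count-< i w L i<L)))
... | no i≮L = contradiction (trans (sym (count-≡ i w)) (vanishes (≮⇒≥ i≮L))) λ ()

total-upper : ∀ f L c → (∀ {x} → x < L → f x ≤ c) → total f L ≤ L * c
total-upper f zero    c _  = z≤n
total-upper f (suc L) c f≤ = +-mono-≤ (f≤ ≤-refl) (total-upper f L c (f≤ ∘ m<n⇒m<1+n))

total-lower : ∀ f a d c → (∀ {x} → x < d + a → c ≤ f x) → d * c + total f a ≤ total f (d + a)
total-lower f a zero    c _  = ≤-refl
total-lower f a (suc d) c ≤f = ≤-trans (≤-reflexive (+-assoc c (d * c) (total f a)))
  (+-mono-≤ (≤f ≤-refl) (total-lower f a d c (≤f ∘ m<n⇒m<1+n)))

-- Removing corners

-- The entry to delete is the largest of row `r`, which sits in the corner. No larger entry bumps: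
-- it would have to make row `suc r` as long as row `r`.
corner-delete : ∀ w r → count w (suc r) < count w r → ∃[ k ] (k < length w × proj₂ (delete w k) ≡ r)
corner-delete (i ∷ w) r corner with i ≟ r
... | yes refl = 0 , z<s , refl
... | no i≢r
  with k , k< , eq ← corner-delete w r
    (≤-trans (s≤s (count-≤-∷ i w (suc r))) (≤-trans corner (≤-reflexive (count-≢ w i≢r)))) =
  suc k , s<s k< , trans (cong proj₂ (push-no-bump w ¬bump)) eq
  where
  ¬bump : ¬ Bump w i (proj₂ (delete w k))
  ¬bump rewrite eq = λ where
    (refl , eq′) → <-irrefl
      (trans (count-≡ i w) (trans (sym eq′) (sym (count-≢ w i≢r)))) corner

-- A discrete intermediate value search from the far end. For row lengths it yields a corner in a
-- column beyond the first `b`.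
descent : ∀ (f : ℕ → ℕ) b x d → b < f x → f (d + x) ≤ b →
          ∃[ r ] (x ≤ r × r < d + x × b < f r × f (suc r) ≤ b)
descent f b x zero    b< ≤b = contradiction b< (≤⇒≯ ≤b)
descent f b x (suc d) b< ≤b with b <? f (d + x)
... | yes b<′ = d + x , m≤n+m x d , ≤-refl , b<′ , ≤b
... | no b≮ with r , x≤r , r< , b<′ , ≤b′ ← descent f b x d b< (≮⇒≥ b≮) =
  r , x≤r , m<n⇒m<1+n r< , b<′ , ≤b′

vanish : ∀ w → ∃[ L ] (∀ {x} → L ≤ x → count w x ≡ 0)
vanish []      = 0 , λ _ → refl
vanish (i ∷ w) with L , v ← vanish w = suc i ⊔ L , λ L≤x →
  trans (count-≢ w (<⇒≢ (m⊔n≤o⇒m≤o (suc i) L L≤x))) (v (m⊔n≤o⇒n≤o (suc i) L L≤x))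

-- The cells weakly north-west of the neighbours of the cell c added in row i fill the
-- rectangle from (0,0) to c, except for c itself; any corner outside of it will do.
avoiding-corner : ∀ s i → Lattice s → suc i * suc (count s i) ≤ length s →
                  ∃[ r ] (count s (suc r) < count s r × r ≢ i × ¬ Bump s i r)
avoiding-corner s i lat big with 0 <? count s (suc i)
-- There are cells below row `i`; a corner among them is too low to cause a bump.
... | yes 0< with L , van ← vanish s
    with r , i<r , _ , 0<r , r≤0 ← descent (count s) 0 (suc i) L 0< (≤-reflexive (van (m≤m+n L (suc i)))) =
  r , ≤-trans (s≤s r≤0) 0<r , (λ { refl → <-irrefl refl i<r }) ,
  λ { (refl , _) → <-irrefl refl (<-trans (n<1+n r) i<r) }
... | no 0≮ with anyUpTo? (λ x → suc (count s i) <? count s x) i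
-- Some row above extends beyond the column of `c`. The corner found has more than `suc (count s i)`
-- cells in its row, while a bump needs exactly that many.
...   | yes (x , x<i , wide)
    with r , x≤r , r< , <r , r≤ ← descent (count s) (suc (count s i)) x (i ∸ x) wide
           (≤-trans (≤-reflexive (cong (count s) (m∸n+n≡m (<⇒≤ x<i)))) (n≤1+n _)) =
  r , ≤-trans (s≤s r≤) <r ,
  (λ { refl → <-irrefl refl (<-≤-trans r< (≤-reflexive (m∸n+n≡m (<⇒≤ x<i)))) }) ,
  λ (_ , eq) → <-irrefl (sym eq) <r
-- Now all cells lie in the rectangle and none of them is `c`, so there are fewer than its area.
...   | no ¬wide = contradiction big (<⇒≱ (begin-strict
  length s                        ≤⟨ length≤total-count s (suc i) empty-below ⟩
  count s i + total (count s) i   ≤⟨ +-monoʳ-≤ (count s i) (total-upper (count s) i _ narrow) ⟩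
  count s i + i * suc (count s i) <⟨ ≤-refl ⟩
  suc i * suc (count s i)         ∎))
  where
  open ≤-Reasoning
  empty-below : ∀ {x} → i < x → count s x ≡ 0
  empty-below i<x = n≤0⇒n≡0 (≤-trans (young⇒antitone (lattice⇒young s lat) i<x) (≮⇒≥ 0≮))
  narrow : ∀ {x} → x < i → count s x ≤ suc (count s i)
  narrow {x} x<i = ≮⇒≥ λ wide → ¬wide (x , x<i , wide)

-- The conclusion is made for a second application: the rectangle of the maximum is unchanged and
-- just one cell is lost.
survives : ∀ s i → Lattice (i ∷ s) → suc i * suc (count s i) ≤ length s →
           ∃[ v ] (i ∷ v ∈ minors (i ∷ s) × count v i ≡ count s i ×
                   suc (length v) ≡ length s × Lattice (i ∷ v))
survives s i lat@(_ , lats) big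
  with r , corner , r≢i , ¬bump ← avoiding-corner s i lats big
  with k , k< , refl ← corner-delete s r corner
  = v , subst (_∈ minors (i ∷ s)) (cong proj₁ eq) (∈-minors⁺ (i ∷ s) {suc k} (s<s k<))
  , trans (sym (count-≢ v r≢i)) (count-↭ (delete-↭ s k<) i)
  , delete-length s k<
  , subst Lattice (cong proj₁ eq) (delete-lattice (i ∷ s) {suc k} lat (s<s k<))
  where
  v = proj₁ (delete s k)
  eq : delete (i ∷ s) (suc k) ≡ (i ∷ v , r)
  eq = push-no-bump s ¬bump

-- Telling two positions of the maximum apart

minor-count : ∀ w {v} → v ∈ minors w → ∀ x → count v x ≤ count w x
minor-count w v∈ x with k , k< , refl ← ∈-minors⁻ w v∈ =
  ≤-trans (count-≤-∷ (proj₂ (delete w k)) (proj₁ (delete w k)) x) (≤-reflexive (count-↭ (delete-↭ w k<) x))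

-- The rectangle without its corner `c` lies in `s`, so a length above its area means two cells
-- outside. Then `survives` applies twice and gives a 2-minor with `suc (count s i)` cells in row
-- `i`, more than a minor of `j ∷ s` can have there.
⊑⇒small : ∀ s i j → Lattice (i ∷ s) → i ≢ j → (i ∷ s) ⊑ (j ∷ s) → length s ≤ suc i * suc (count s i)
⊑⇒small s i j lat i≢j sub = ≮⇒≥ λ big → absurd big
  where
  absurd : suc i * suc (count s i) < length s → ⊥
  absurd big
    with v , v∈ , ceq , leq , latv ← survives s i lat (<⇒≤ big)
    with u , u∈ , ceq′ , _ ← survives v i latv
           (s≤s⁻¹ (subst₂ (λ c l → suc i * suc c < l) (sym ceq) (sym leq) big))
    with y , y∈ , u∈y ← ∈-minors₂⁻ (j ∷ s) (sub _ (∈-minors₂⁺ (i ∷ s) v∈ u∈)) = <-irrefl refl (begin-strict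
      count s i       ≡⟨ trans (sym ceq) (sym ceq′) ⟩
      count u i       <⟨ ≤-reflexive (sym (count-≡ i u)) ⟩
      count (i ∷ u) i ≤⟨ minor-count y u∈y i ⟩
      count y i       ≤⟨ minor-count (j ∷ s) y∈ i ⟩
      count (j ∷ s) i ≡⟨ count-≢ s (i≢j ∘ sym) ⟩
      count s i       ∎)
    where open ≤-Reasoning

-- Here `q` and `p` are the lengths of the lower and the upper row, with `d` rows in between. The
-- lower bound counts row by row: `q`, at least `suc q` for each row between, `p`, and at least
-- `suc p` for each of the `i` rows on top. Of these cells `d * suc q + q` lie below the upper
-- rectangle and `e + i * suc e` to the right of the lower one; the upper bounds allow one cell
-- each.
small-rectangles : ∀ i d q e {L} → (let p = suc (e + q)) →
  q + (d * suc q + (p + i * suc p)) ≤ L → L ≤ suc i * suc p → L ≤ suc (suc (d + i)) * suc q → L ≤ 6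
small-rectangles i d q e {L} lower upperᵢ upperⱼ = bound i q e upperᵢ q≤1 ei≤1
  where
  p = suc (e + q)
  R = p + i * suc p
  d+q≤1 : d * suc q + q ≤ 1
  d+q≤1 = +-cancelʳ-≤ R _ _ (≤-trans (≤-reflexive (eq (d * suc q) q R)) (≤-trans lower upperᵢ))
    where
    eq : ∀ a q R → a + q + R ≡ q + (a + R)
    eq = solve-∀
  q≤1 : q ≤ 1
  q≤1 = ≤-trans (m≤n+m q _) d+q≤1
  ei≤1 : e + i * suc e ≤ 1
  ei≤1 = +-cancelʳ-≤ (d * suc q + i * suc q + q + suc q) _ _
    (≤-trans (≤-reflexive (eq₁ i d q e)) (≤-trans (≤-trans lower upperⱼ) (≤-reflexive (eq₂ i d q))))
    where
    eq₁ : ∀ i d q e → e + i * suc e + (d * suc q + i * suc q + q + suc q) ≡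
                      q + (d * suc q + (suc (e + q) + i * suc (suc (e + q))))
    eq₁ = solve-∀
    eq₂ : ∀ i d q → suc (suc (d + i)) * suc q ≡ 1 + (d * suc q + i * suc q + q + suc q)
    eq₂ = solve-∀
  -- What remains is `i = 0` with `e ≤ 1`, giving at most 4 cells, and `i = 1` with `e = 0`, giving
  -- at most 6.
  bound : ∀ i q e → L ≤ suc i * suc (suc (e + q)) → q ≤ 1 → e + i * suc e ≤ 1 → L ≤ 6
  bound zero q e L≤ q≤1 e≤1 = ≤-trans L≤ (≤-trans
    (+-monoˡ-≤ 0 (s≤s (s≤s (+-mono-≤ (≤-trans (m≤m+n e 0) e≤1) q≤1)))) (m≤m+n 4 2))
  bound (suc zero) q zero L≤ q≤1 _ = ≤-trans L≤ (*-monoʳ-≤ 2 (s≤s (s≤s q≤1)))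
  bound (suc zero) q (suc e) L≤ q≤1 (s≤s e≤) = contradiction (≤-trans (m≤n+m _ e) e≤) λ ()
  bound (suc (suc i)) q e L≤ q≤1 ei≤1 = contradiction
    (≤-trans (m≤n+m _ e) ei≤1) (<⇒≱ (s≤s (≤-trans (s≤s z≤n) (m≤n+m _ e))))

-- Mutual inclusion would leave at most one cell of `s` outside each of the two rectangles, which is
-- impossible with seven cells.
separated-below : ∀ s i j d → suc (d + i) ≡ j → Lattice (i ∷ s) → Lattice (j ∷ s) → 7 ≤ length s →
                  (i ∷ s) ⊑ (j ∷ s) → ¬ ((j ∷ s) ⊑ (i ∷ s))
separated-below s i j d refl lati@(addi , lat) latj@(addj , _) 7≤ i⊑j j⊑i =
  <⇒≱ 7≤ (small-rectangles i d q e
    (subst (λ p → q + (d * suc q + (p + i * suc p)) ≤ length s) p≡ lower)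
    (subst (λ p → length s ≤ suc i * suc p) p≡ (⊑⇒small s i j lati i≢j i⊑j))
    (⊑⇒small s j i latj (i≢j ∘ sym) j⊑i))
  where
  f = count s
  q = f j
  e = f i ∸ suc q
  i≢j : i ≢ j
  i≢j = <⇒≢ (s≤s (m≤n+m i d))
  -- The subtraction in `e` is not truncated: a cell fits at the end of row `j`, so the rows above
  -- are longer than `q`.
  p≡ : f i ≡ suc (e + q)
  p≡ = trans (sym (m∸n+n≡m (≤-trans addj (young⇒antitone (lattice⇒young s lat) (m≤n+m i d))))) (+-suc e q)
  above : ∀ i {x} → Addable f i → x < i → suc (f i) ≤ f x
  above (suc i) add x<i = ≤-trans add (young⇒antitone (lattice⇒young s lat) (s≤s⁻¹ x<i))
  upper-part : i * suc (f i) ≤ total f i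
  upper-part = subst₂ (λ a b → a ≤ total f b) (+-identityʳ _) (+-identityʳ i)
    (total-lower f 0 i (suc (f i)) λ {x} x< → above i addi (subst (x <_) (+-identityʳ i) x<))
  lower : q + (d * suc q + (f i + i * suc (f i))) ≤ length s
  lower = begin
    q + (d * suc q + (f i + i * suc (f i))) ≤⟨ +-monoʳ-≤ q (+-monoʳ-≤ (d * suc q) (+-monoʳ-≤ (f i) upper-part)) ⟩
    q + (d * suc q + total f (suc i))       ≤⟨ +-monoʳ-≤ q (total-lower f (suc i) d (suc q) λ {x} x< → above j addj (subst (x <_) (+-suc d i) x<)) ⟩
    q + total f (d + suc i)                 ≡⟨ cong (λ L → q + total f L) (+-suc d i) ⟩
    total f (suc j)                         ≤⟨ total-count≤length s (suc j) ⟩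
    length s                                ∎
    where open ≤-Reasoning

separated : ∀ s i j → Lattice (i ∷ s) → Lattice (j ∷ s) → 7 ≤ length s →
            (i ∷ s) ⊑ (j ∷ s) → (j ∷ s) ⊑ (i ∷ s) → i ≡ j
separated s i j lati latj 7≤ i⊑j j⊑i with <-cmp i j
... | tri≈ _ i≡j _ = i≡j
... | tri< i<j _ _ = contradiction j⊑i
  (separated-below s i j (j ∸ suc i) (trans (sym (+-suc _ i)) (m∸n+n≡m i<j)) lati latj 7≤ i⊑j)
... | tri> _ _ j<i = contradiction i⊑j
  (separated-below s j i (i ∸ suc j) (trans (sym (+-suc _ j)) (m∸n+n≡m j<i)) latj lati 7≤ j⊑i)

-- Length eight by exhaustive search

extensions : Word → List Word
extensions w = map (_∷ w) (filter (addable? (count w)) (upTo (suc (length w))))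

-- A cell in row `x` rests on a cell in each row above it. Hence the candidate range in `extensions`
-- misses nothing.
occurs⇒<length : ∀ w → Lattice w → ∀ {x} → 0 < count w x → x < length w
addable⇒≤length : ∀ w i → Lattice (i ∷ w) → i ≤ length w
addable⇒≤length w zero    _           = z≤n
addable⇒≤length w (suc i) (add , lat) = occurs⇒<length w lat (≤-trans (s≤s z≤n) add)
occurs⇒<length (i ∷ w) lat {x} 0< with i ≟ x
... | yes refl = s≤s (addable⇒≤length w i lat)
... | no i≢x   = m<n⇒m<1+n (occurs⇒<length w (proj₂ lat) (subst (0 <_) (count-≢ w i≢x) 0<))

∈-extensions : ∀ i w → Lattice (i ∷ w) → i ∷ w ∈ extensions w
∈-extensions i w lat = ∈-map⁺ (_∷ w)
  (∈-filter⁺ (addable? (count w)) (∈-upTo⁺ (s≤s (addable⇒≤length w i lat))) (proj₁ lat))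

-- Testing equality first spares the search the 2-minors of pairs on the diagonal.
Confusable : Word × Word → Set
Confusable (v , w) = v ≡ w ⊎ (minors₂ v ⊆ minors₂ w × minors₂ w ⊆ minors₂ v)

confusable? : ∀ p → Dec (Confusable p)
confusable? (v , w) = v ≟ʷ w ⊎-dec (minors₂ v ⊆? minors₂ w ×-dec minors₂ w ⊆? minors₂ v)

-- By `⊑-restrict` only pairs whose tails are already confusable need to be extended, which keeps
-- the search far below all pairs of tableaux.
confusable : ℕ → List (Word × Word)
confusable zero    = ([] , []) ∷ []
confusable (suc n) = filter confusable?
  (concatMap (λ (v , w) → cartesianProductWith _,_ (extensions v) (extensions w)) (confusable n))

∈-confusable : ∀ {n} v w → length v ≡ n → length w ≡ n → Lattice v → Lattice w →
               v ⊑ w → w ⊑ v → (v , w) ∈ confusable n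
∈-confusable []      []      refl refl _ _ _ _ = here refl
∈-confusable (i ∷ v) (j ∷ w) refl leq latv latw v⊑w w⊑v = ∈-filter⁺ confusable?
  (∈-concatMap⁺ _ (lose
    (∈-confusable v w refl (suc-injective leq) (proj₂ latv) (proj₂ latw)
      (⊑-restrict i v j w v⊑w) (⊑-restrict j w i v w⊑v))
    (∈-cartesianProductWith⁺ _,_ (∈-extensions i v latv) (∈-extensions j w latw))))
  (inj₂ (v⊑w _ , w⊑v _))

Diagonal : List (Word × Word) → Set
Diagonal = All λ (v , w) → v ≡ w

Reconstructible : ℕ → Set
Reconstructible n = ∀ v w → length v ≡ n → length w ≡ n → Lattice v → Lattice w → v ⊑ w → w ⊑ v → v ≡ w

diagonal⇒reconstructible : ∀ {n} → Diagonal (confusable n) → Reconstructible n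
diagonal⇒reconstructible diag v w lv lw latv latw v⊑w w⊑v =
  All.lookup diag (∈-confusable v w lv lw latv latw v⊑w w⊑v)

diagonal? : ∀ ps → Dec (Diagonal ps)
diagonal? = all? (λ (v , w) → v ≟ʷ w)

-- Only the boolean is evaluated: normalising the proof inside the decision is much slower.
confusable-8-does : does (diagonal? (confusable 8)) ≡ true
confusable-8-does = refl

from-does : ∀ {A : Set} (a? : Dec A) → does a? ≡ true → A
from-does (yes a) _ = a

confusable-8-diagonal : Diagonal (confusable 8)
confusable-8-diagonal = from-does (diagonal? (confusable 8)) confusable-8-does

reconstructible-8 : Reconstructible 8
reconstructible-8 = diagonal⇒reconstructible {8} confusable-8-diagonal

-- The induction hypothesis identifies the tails. The common tail has `n` letters, enough for
-- `separated` to identify the heads.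
reconstructible-suc : ∀ {n} → 7 ≤ n → Reconstructible n → Reconstructible (suc n)
reconstructible-suc 7≤ rec (i ∷ v) (j ∷ w) refl lw latv latw v⊑w w⊑v =
  same-head w (rec v w refl (suc-injective lw) (proj₂ latv) (proj₂ latw)
                (⊑-restrict i v j w v⊑w) (⊑-restrict j w i v w⊑v)) latw v⊑w w⊑v
  where
  same-head : ∀ w → v ≡ w → Lattice (j ∷ w) → (i ∷ v) ⊑ (j ∷ w) → (j ∷ w) ⊑ (i ∷ v) → i ∷ v ≡ j ∷ w
  same-head _ refl latw v⊑w w⊑v = cong (_∷ v) (separated v i j latv latw 7≤ v⊑w w⊑v)

reconstructible-+ : Reconstructible 8 → ∀ k → Reconstructible (k + 8)
reconstructible-+ base zero    = base
reconstructible-+ base (suc k) =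
  reconstructible-suc (≤-trans (m≤m+n 7 1) (m≤n+m 8 k)) (reconstructible-+ base k)

-- Tableaux decoded from words

add : Tableau → ℕ → ℕ → Tableau
add []       zero    v = (v ∷ []) ∷ []
-- A default for a row that would leave a gap; by `decode-fits` lattice words never reach it.
add []       (suc i) v = []
add (r ∷ rs) zero    v = (r ∷ʳ v) ∷ rs
add (r ∷ rs) (suc i) v = r ∷ add rs i v

decode : Word → Tableau
decode []      = []
decode (i ∷ w) = add (decode w) i (suc (length w))

rowLen : Tableau → ℕ → ℕ
rowLen []       x       = 0
rowLen (r ∷ rs) zero    = length r
rowLen (r ∷ rs) (suc x) = rowLen rs x

length-∷ʳ : ∀ (r : List ℕ) v → length (r ∷ʳ v) ≡ suc (length r)
length-∷ʳ r v = trans (length-++ r) (+-comm (length r) 1)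

-- Lookup

at-just⇒< : ∀ r {y u} → at r y ≡ just u → y < length r
at-just⇒< (x ∷ r) {zero}  eq = z<s
at-just⇒< (x ∷ r) {suc y} eq = s<s (at-just⇒< r eq)

at2-just⇒< : ∀ T {x y u} → at2 T x y ≡ just u → y < rowLen T x
at2-just⇒< (r ∷ T) {zero}  eq = at-just⇒< r eq
at2-just⇒< (r ∷ T) {suc x} eq = at2-just⇒< T eq

≥⇒at-nothing : ∀ r {y} → length r ≤ y → at r y ≡ nothing
≥⇒at-nothing []      _         = refl
≥⇒at-nothing (x ∷ r) (s≤s r≤y) = ≥⇒at-nothing r r≤y

≥⇒at2-nothing : ∀ T x {y} → rowLen T x ≤ y → at2 T x y ≡ nothing
≥⇒at2-nothing []      x       _  = refl
≥⇒at2-nothing (r ∷ T) zero    ≤y = ≥⇒at-nothing r ≤y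
≥⇒at2-nothing (r ∷ T) (suc x) ≤y = ≥⇒at2-nothing T x ≤y

at-nothing⇒≥ : ∀ r {y} → at r y ≡ nothing → length r ≤ y
at-nothing⇒≥ []              eq = z≤n
at-nothing⇒≥ (x ∷ r) {suc y} eq = s≤s (at-nothing⇒≥ r eq)

at2-nothing⇒≥ : ∀ T x {y} → at2 T x y ≡ nothing → rowLen T x ≤ y
at2-nothing⇒≥ []      x       eq = z≤n
at2-nothing⇒≥ (r ∷ T) zero    eq = at-nothing⇒≥ r eq
at2-nothing⇒≥ (r ∷ T) (suc x) eq = at2-nothing⇒≥ T x eq

All² : (ℕ → Set) → Tableau → Set
All² P = All (All P)

at-All : ∀ {P : ℕ → Set} {r y u} → All P r → at r y ≡ just u → P u
at-All {y = zero}  (p ∷ _)  refl = p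
at-All {y = suc y} (_ ∷ ps) eq   = at-All ps eq

at2-All² : ∀ {P : ℕ → Set} {T} x {y u} → All² P T → at2 T x y ≡ just u → P u
at2-All² zero    (p ∷ _)  eq = at-All p eq
at2-All² (suc x) (_ ∷ ps) eq = at2-All² x ps eq

setAt-All : ∀ {P : ℕ → Set} {r} y {u} → All P r → P u → All P (setAt r y u)
setAt-All y       []       pu = []
setAt-All zero    (_ ∷ ps) pu = pu ∷ ps
setAt-All (suc y) (p ∷ ps) pu = p ∷ setAt-All y ps pu

set2-All² : ∀ {P : ℕ → Set} {T} x y {u} → All² P T → P u → All² P (set2 T x y u)
set2-All² x       y []       pu = []
set2-All² zero    y (p ∷ ps) pu = setAt-All y p pu ∷ ps
set2-All² (suc x) y (p ∷ ps) pu = p ∷ set2-All² x y ps pu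

length-setAt : ∀ r y u → length (setAt r y u) ≡ length r
length-setAt []      y       u = refl
length-setAt (x ∷ r) zero    u = refl
length-setAt (x ∷ r) (suc y) u = cong suc (length-setAt r y u)

rowLen-set2 : ∀ T x y u z → rowLen (set2 T x y u) z ≡ rowLen T z
rowLen-set2 []      x       y u z       = refl
rowLen-set2 (r ∷ T) zero    y u zero    = length-setAt r y u
rowLen-set2 (r ∷ T) zero    y u (suc z) = refl
rowLen-set2 (r ∷ T) (suc x) y u zero    = refl
rowLen-set2 (r ∷ T) (suc x) y u (suc z) = rowLen-set2 T x y u z

nonEmpty-setAt : ∀ r y u → NonEmpty r → NonEmpty (setAt r y u)
nonEmpty-setAt (x ∷ r) zero    u _ = tt
nonEmpty-setAt (x ∷ r) (suc y) u _ = tt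

nonEmpty-set2 : ∀ T x y u → AllRows NonEmpty T → AllRows NonEmpty (set2 T x y u)
nonEmpty-set2 []      x       y u _        = tt
nonEmpty-set2 (r ∷ T) zero    y u (p , ps) = nonEmpty-setAt r y u p , ps
nonEmpty-set2 (r ∷ T) (suc x) y u (p , ps) = p , nonEmpty-set2 T x y u ps

-- Adding a cell

occupied⇒<length : ∀ T x → 0 < rowLen T x → x < length T
occupied⇒<length (r ∷ T) zero    _  = z<s
occupied⇒<length (r ∷ T) (suc x) 0< = s<s (occupied⇒<length T x 0<)

addable⇒fits : ∀ {f} T i → (∀ x → rowLen T x ≡ f x) → Addable f i → i ≤ length T
addable⇒fits T zero    len _ = z≤n
addable⇒fits T (suc i) len a = occupied⇒<length T i (subst (0 <_) (sym (len i)) (≤-trans (s≤s z≤n) a))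

at-∷ʳ-old : ∀ r v {y} → y < length r → at (r ∷ʳ v) y ≡ at r y
at-∷ʳ-old (x ∷ r) v {zero}  y< = refl
at-∷ʳ-old (x ∷ r) v {suc y} y< = at-∷ʳ-old r v (s≤s⁻¹ y<)

at-∷ʳ-new : ∀ r v → at (r ∷ʳ v) (length r) ≡ just v
at-∷ʳ-new []      v = refl
at-∷ʳ-new (x ∷ r) v = at-∷ʳ-new r v

at-∷ʳ⁻ : ∀ r v y {b} → at (r ∷ʳ v) y ≡ just b → at r y ≡ just b ⊎ b ≡ v
at-∷ʳ⁻ []      v zero    refl = inj₂ refl
at-∷ʳ⁻ (x ∷ r) v zero    eq   = inj₁ eq
at-∷ʳ⁻ (x ∷ r) v (suc y) eq   = at-∷ʳ⁻ r v y eq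

at2-add-old : ∀ T i v x {y} → y < rowLen T x → at2 (add T i v) x y ≡ at2 T x y
at2-add-old (r ∷ T) zero    v zero    y< = at-∷ʳ-old r v y<
at2-add-old (r ∷ T) zero    v (suc x) y< = refl
at2-add-old (r ∷ T) (suc i) v zero    y< = refl
at2-add-old (r ∷ T) (suc i) v (suc x) y< = at2-add-old T i v x y<

at2-add-new : ∀ T i v → i ≤ length T → at2 (add T i v) i (rowLen T i) ≡ just v
at2-add-new []      zero    v _  = refl
at2-add-new (r ∷ T) zero    v _  = at-∷ʳ-new r v
at2-add-new (r ∷ T) (suc i) v i≤ = at2-add-new T i v (s≤s⁻¹ i≤)

at2-add⁻ : ∀ T i v x y {b} → at2 (add T i v) x y ≡ just b → at2 T x y ≡ just b ⊎ b ≡ v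
at2-add⁻ []      zero    v zero    zero eq = inj₂ (sym (just-injective eq))
at2-add⁻ (r ∷ T) zero    v zero    y eq = at-∷ʳ⁻ r v y eq
at2-add⁻ (r ∷ T) zero    v (suc x) y eq = inj₁ eq
at2-add⁻ (r ∷ T) (suc i) v zero    y eq = inj₁ eq
at2-add⁻ (r ∷ T) (suc i) v (suc x) y eq = at2-add⁻ T i v x y eq

rowLen-add-≡ : ∀ T i v → i ≤ length T → rowLen (add T i v) i ≡ suc (rowLen T i)
rowLen-add-≡ []      zero    v _  = refl
rowLen-add-≡ (r ∷ T) zero    v _  = length-∷ʳ r v
rowLen-add-≡ (r ∷ T) (suc i) v i≤ = rowLen-add-≡ T i v (s≤s⁻¹ i≤)

rowLen-add-≢ : ∀ T {i} v {x} → i ≢ x → rowLen (add T i v) x ≡ rowLen T x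
rowLen-add-≢ []      {zero}  v {zero}  i≢x = contradiction refl i≢x
rowLen-add-≢ []      {zero}  v {suc x} i≢x = refl
rowLen-add-≢ []      {suc i} v {x}     i≢x = refl
rowLen-add-≢ (r ∷ T) {zero}  v {zero}  i≢x = contradiction refl i≢x
rowLen-add-≢ (r ∷ T) {zero}  v {suc x} i≢x = refl
rowLen-add-≢ (r ∷ T) {suc i} v {zero}  i≢x = refl
rowLen-add-≢ (r ∷ T) {suc i} v {suc x} i≢x = rowLen-add-≢ T v (i≢x ∘ cong suc)

setAt-∷ʳ : ∀ r v {y} u → y < length r → setAt (r ∷ʳ v) y u ≡ setAt r y u ∷ʳ v
setAt-∷ʳ (x ∷ r) v {zero}  u y< = refl
setAt-∷ʳ (x ∷ r) v {suc y} u y< = cong (x ∷_) (setAt-∷ʳ r v u (s≤s⁻¹ y<))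

set2-add : ∀ T i v x {y} u → y < rowLen T x → set2 (add T i v) x y u ≡ add (set2 T x y u) i v
set2-add (r ∷ T) zero    v zero    u y< = cong (_∷ T) (setAt-∷ʳ r v u y<)
set2-add (r ∷ T) zero    v (suc x) u y< = refl
set2-add (r ∷ T) (suc i) v zero    u y< = refl
set2-add (r ∷ T) (suc i) v (suc x) u y< = cong (r ∷_) (set2-add T i v x u y<)

add-All² : ∀ {P : ℕ → Set} {T} i {v} → All² P T → P v → All² P (add T i v)
add-All² zero    []       pv = (pv ∷ []) ∷ []
add-All² (suc i) []       pv = []
add-All² zero    (p ∷ ps) pv = All.∷ʳ⁺ p pv ∷ ps
add-All² (suc i) (p ∷ ps) pv = p ∷ add-All² i ps pv

nonEmpty-∷ʳ : ∀ (r : List ℕ) v → NonEmpty (r ∷ʳ v)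
nonEmpty-∷ʳ []      v = tt
nonEmpty-∷ʳ (x ∷ r) v = tt

nonEmpty-add : ∀ T i v → AllRows NonEmpty T → AllRows NonEmpty (add T i v)
nonEmpty-add []      zero    v _        = tt , tt
nonEmpty-add []      (suc i) v _        = tt
nonEmpty-add (r ∷ T) zero    v (_ , ps) = nonEmpty-∷ʳ r v , ps
nonEmpty-add (r ∷ T) (suc i) v (p , ps) = p , nonEmpty-add T i v ps

map-add : ∀ (g : ℕ → ℕ) T i v → map (map g) (add T i v) ≡ add (map (map g) T) i (g v)
map-add g []      zero    v = refl
map-add g []      (suc i) v = refl
map-add g (r ∷ T) zero    v = cong (_∷ map (map g) T) (map-++ g r (v ∷ []))
map-add g (r ∷ T) (suc i) v = cong (map g r ∷_) (map-add g T i v)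

size-add : ∀ T i v → i ≤ length T → size (add T i v) ≡ suc (size T)
size-add []      zero    v _  = refl
size-add (r ∷ T) zero    v _  = cong (_+ size T) (length-∷ʳ r v)
size-add (r ∷ T) (suc i) v i≤ = trans (cong (length r +_) (size-add T i v (s≤s⁻¹ i≤))) (+-suc (length r) (size T))

-- Removing a cell

-- The case distinction inside `remove2`, which drops an emptied row, as a function open to
-- equational reasoning.
consRow : List ℕ → Tableau → Tableau
consRow []      T = T
consRow (x ∷ r) T = (x ∷ r) ∷ T

consRow-∷ : ∀ r T → NonEmpty r → consRow r T ≡ r ∷ T
consRow-∷ (x ∷ r) T _ = refl

remove2-zero : ∀ r T y → remove2 (r ∷ T) 0 y ≡ consRow (removeAt r y) T
remove2-zero r T y with removeAt r y
... | []    = refl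
... | _ ∷ _ = refl

removeAt-last : ∀ r v → removeAt (r ∷ʳ v) (length r) ≡ r
removeAt-last []      v = refl
removeAt-last (x ∷ r) v = cong (x ∷_) (removeAt-last r v)

removeAt-∷ʳ : ∀ r v {y} → y < length r → removeAt (r ∷ʳ v) y ≡ removeAt r y ∷ʳ v
removeAt-∷ʳ (x ∷ r) v {zero}  y< = refl
removeAt-∷ʳ (x ∷ r) v {suc y} y< = cong (x ∷_) (removeAt-∷ʳ r v (s≤s⁻¹ y<))

setAt-last : ∀ r v {y} → length r ≡ suc y → setAt r y v ≡ removeAt r y ∷ʳ v
setAt-last (x ∷ []) v {zero}  eq = refl
setAt-last (x ∷ r)  v {suc y} eq = cong (x ∷_) (setAt-last r v (suc-injective eq))

nonEmpty-removeAt : ∀ r y → 1 < length r → NonEmpty (removeAt r y)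
nonEmpty-removeAt (x ∷ z ∷ r) zero    _ = tt
nonEmpty-removeAt (x ∷ z ∷ r) (suc y) _ = tt
nonEmpty-removeAt (x ∷ [])    y (s≤s ())

remove2-add-new : ∀ T i v → AllRows NonEmpty T → i ≤ length T → remove2 (add T i v) i (rowLen T i) ≡ T
remove2-add-new []      zero    v _       _  = refl
remove2-add-new (r ∷ T) zero    v (p , _) _  = trans (remove2-zero (r ∷ʳ v) T (length r))
  (trans (cong (λ r → consRow r T) (removeAt-last r v)) (consRow-∷ r T p))
remove2-add-new (r ∷ T) (suc i) v (_ , ps) i≤ = cong (r ∷_) (remove2-add-new T i v ps (s≤s⁻¹ i≤))

-- Were a row above row `i` emptied, the rows below would move up and `i` would name the wrong one;
-- the length condition prevents this.
remove2-add-other : ∀ T i v x {y} → i ≢ x → y < rowLen T x → (x < i → 1 < rowLen T x) →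
                    remove2 (add T i v) x y ≡ add (remove2 T x y) i v
remove2-add-other (r ∷ T) zero v zero i≢x _ _ = contradiction refl i≢x
remove2-add-other (r ∷ T) zero v (suc x) i≢x _ _ = refl
remove2-add-other (r ∷ T) (suc i) v zero {y} i≢x _ long = begin
  remove2 (r ∷ add T i v) 0 y         ≡⟨ remove2-zero r (add T i v) y ⟩
  consRow (removeAt r y) (add T i v)  ≡⟨ consRow-∷ _ _ ne ⟩
  removeAt r y ∷ add T i v            ≡⟨ cong (λ U → add U (suc i) v) (sym (consRow-∷ _ _ ne)) ⟩
  add (consRow (removeAt r y) T) (suc i) v ≡⟨ cong (λ U → add U (suc i) v) (sym (remove2-zero r T y)) ⟩
  add (remove2 (r ∷ T) 0 y) (suc i) v ∎
  where
  open ≡-Reasoning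
  ne = nonEmpty-removeAt r y (long z<s)
remove2-add-other (r ∷ T) (suc i) v (suc x) i≢x y< long =
  cong (r ∷_) (remove2-add-other T i v x (i≢x ∘ cong suc) y< (long ∘ s<s))

consRow-add : ∀ r T v → NonEmpty r ⊎ T ≡ [] → (r ∷ʳ v) ∷ T ≡ add (consRow r T) 0 v
consRow-add []      _ v (inj₂ refl) = refl
consRow-add (x ∷ r) T v _           = refl

-- If the removal empties `r`, then `y` is 0, and a next row would have to be empty.
no-further-rows : ∀ r T {y} → AllRows NonEmpty T → length r ≡ suc y → rowLen T 0 ≤ y → NonEmpty (removeAt r y) ⊎ T ≡ []
no-further-rows r [] _ _ _ = inj₂ refl
no-further-rows r (t@(_ ∷ _) ∷ T) {y} ne eq t≤y =
  inj₁ (nonEmpty-removeAt r y (subst (1 <_) (sym eq) (s≤s (≤-trans (s≤s z≤n) t≤y))))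

-- The maximum sits just to the right of the hole and slides left, staying in its row.
remove2-slid-left : ∀ T i v {y} → AllRows NonEmpty T → rowLen T i ≡ suc y → rowLen T (suc i) ≤ y →
                    remove2 (set2 (add T i v) i y v) i (suc y) ≡ add (remove2 T i y) i v
remove2-slid-left (r ∷ T) zero v {y} (_ , ps) eq ≤y = begin
  remove2 (setAt (r ∷ʳ v) y v ∷ T) 0 (suc y)        ≡⟨ remove2-zero (setAt (r ∷ʳ v) y v) T (suc y) ⟩
  consRow (removeAt (setAt (r ∷ʳ v) y v) (suc y)) T ≡⟨ cong (λ r → consRow r T) row ⟩
  consRow (removeAt r y ∷ʳ v) T                     ≡⟨ consRow-∷ (removeAt r y ∷ʳ v) T (nonEmpty-∷ʳ (removeAt r y) v) ⟩
  (removeAt r y ∷ʳ v) ∷ T                           ≡⟨ consRow-add _ T v (no-further-rows r T ps eq ≤y) ⟩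
  add (consRow (removeAt r y) T) 0 v                ≡⟨ cong (λ U → add U 0 v) (sym (remove2-zero r T y)) ⟩
  add (remove2 (r ∷ T) 0 y) 0 v                     ∎
  where
  open ≡-Reasoning
  row : removeAt (setAt (r ∷ʳ v) y v) (suc y) ≡ removeAt r y ∷ʳ v
  row = begin
    removeAt (setAt (r ∷ʳ v) y v) (suc y)                  ≡⟨ cong (λ r → removeAt r (suc y)) (setAt-∷ʳ r v v (≤-reflexive (sym eq))) ⟩
    removeAt (setAt r y v ∷ʳ v) (suc y)                    ≡⟨ cong (removeAt (setAt r y v ∷ʳ v)) (sym (trans (length-setAt r y v) eq)) ⟩
    removeAt (setAt r y v ∷ʳ v) (length (setAt r y v))     ≡⟨ removeAt-last (setAt r y v) v ⟩
    setAt r y v                                            ≡⟨ setAt-last r v eq ⟩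
    removeAt r y ∷ʳ v                                      ∎
remove2-slid-left (r ∷ T) (suc i) v (_ , ps) eq ≤y = cong (r ∷_) (remove2-slid-left T i v ps eq ≤y)

-- This is the bump: the maximum sits just below the hole and slides up into row `x`.
remove2-slid-up : ∀ T x v {y} → AllRows NonEmpty T → rowLen T x ≡ suc y → rowLen T (suc x) ≡ y →
                  remove2 (set2 (add T (suc x) v) x y v) (suc x) y ≡ add (remove2 T x y) x v
remove2-slid-up (r ∷ T) zero v {y} (_ , ps) eq eq′ = begin
  setAt r y v ∷ remove2 (add T 0 v) 0 y            ≡⟨ cong (λ z → setAt r y v ∷ remove2 (add T 0 v) 0 z) (sym eq′) ⟩
  setAt r y v ∷ remove2 (add T 0 v) 0 (rowLen T 0) ≡⟨ cong₂ _∷_ (setAt-last r v eq) (remove2-add-new T 0 v ps z≤n) ⟩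
  (removeAt r y ∷ʳ v) ∷ T                          ≡⟨ consRow-add _ T v (no-further-rows r T ps eq (≤-reflexive eq′)) ⟩
  add (consRow (removeAt r y) T) 0 v               ≡⟨ cong (λ U → add U 0 v) (sym (remove2-zero r T y)) ⟩
  add (remove2 (r ∷ T) 0 y) 0 v                    ∎
  where open ≡-Reasoning
remove2-slid-up (r ∷ T) (suc x) v (_ , ps) eq eq′ = cong (r ∷_) (remove2-slid-up T x v ps eq eq′)

-- Sliding paths

-- The graph of `slide` without fuel. The first index is the number of moves and the last the row
-- where the hole stops. Ties go down, as with the test `r <ᵇ b`.
data Slide : ℕ → Tableau → ℕ → ℕ → Tableau → ℕ → Set where
  halt  : ∀ {T x y} → at2 T x (suc y) ≡ nothing → at2 T (suc x) y ≡ nothing →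
          Slide 0 T x y (remove2 T x y) x
  right : ∀ {k T x y u U q} → at2 T x (suc y) ≡ just u →
          (∀ {b} → at2 T (suc x) y ≡ just b → u < b) →
          Slide k (set2 T x y u) x (suc y) U q → Slide (suc k) T x y U q
  down  : ∀ {k T x y u U q} → at2 T (suc x) y ≡ just u →
          (∀ {b} → at2 T x (suc y) ≡ just b → u ≤ b) →
          Slide k (set2 T x y u) (suc x) y U q → Slide (suc k) T x y U q

slide-Slide : ∀ {k fuel T x y U q} → Slide k T x y U q → k ≤ fuel → slide fuel T x y ≡ U
slide-Slide {fuel = zero}  (halt _ _) _ = refl
slide-Slide {fuel = suc _} (halt er eb) _ rewrite er | eb = refl
slide-Slide {fuel = suc _} {T} {x} {y} (right {u = u} er u< s) (s≤s k≤) with at2 T (suc x) y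
... | nothing rewrite er = slide-Slide s k≤
... | just b rewrite er | dec-true (u <? b) (u< refl) = slide-Slide s k≤
slide-Slide {fuel = suc _} {T} {x} {y} (down {u = u} eb u≤ s) (s≤s k≤) with at2 T x (suc y)
... | nothing rewrite eb = slide-Slide s k≤
... | just r rewrite eb | dec-false (r <? u) (≤⇒≯ (u≤ refl)) = slide-Slide s k≤

-- The graph of `push` in terms of row lengths: the two indices are the new row of the maximum and
-- the row finally vacated.
data Outcome (f : ℕ → ℕ) (i q : ℕ) : ℕ → ℕ → Set where
  bumped : suc q ≡ i × f q ≡ suc (f i) → Outcome f i q q i
  kept   : ¬ (suc q ≡ i × f q ≡ suc (f i)) → Outcome f i q i q

-- The hole has reached a corner of `P`, so only the maximum can still move. To the right of the
-- hole it slides left, which counts as `kept`; directly below it slides up; elsewhere the path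
-- halts at once.
stop-add : ∀ {f i v} P x y → Young f → Addable f i →
           (∀ z → rowLen P z ≡ f z) → AllRows NonEmpty P → f x ≡ suc y → f (suc x) ≤ y →
           ∃[ i′ ] ∃[ q′ ] ∃[ k′ ] (Outcome f i x i′ q′ × k′ ≤ 1 ×
                                    Slide k′ (add P i v) x y (add (remove2 P x y) i′ v) q′)
stop-add {f} {i} {v} P x y yng addb len ne fx≡ ≤y with i ≟ x | suc x ≟ i ×-dec f x ≟ suc (f i)
... | yes refl | _ = i , i , 1 , kept (1+n≢n ∘ proj₁) , ≤-refl ,
  right
    (subst (λ y → at2 (add P i v) i y ≡ just v) (trans (len i) fx≡) (at2-add-new P i v fits))
    (λ eb → contradiction (trans (sym eb) (≥⇒at2-nothing (add P i v) (suc i) below)) λ ())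
    (subst (λ V → Slide 0 T′ i (suc y) V i)
      (remove2-slid-left P i v ne (trans (len i) fx≡) (≤-trans (≤-reflexive (len (suc i))) ≤y))
      (halt
        (≥⇒at2-nothing T′ i (≤-reflexive (begin
          rowLen T′ i            ≡⟨ rowLen-set2 (add P i v) i y v i ⟩
          rowLen (add P i v) i   ≡⟨ rowLen-add-≡ P i v fits ⟩
          suc (rowLen P i)       ≡⟨ cong suc (trans (len i) fx≡) ⟩
          suc (suc y)            ∎)))
        (≥⇒at2-nothing T′ (suc i)
          (≤-trans (≤-reflexive (rowLen-set2 (add P i v) i y v (suc i))) (m≤n⇒m≤1+n below)))))
  where
  open ≡-Reasoning
  T′ = set2 (add P i v) i y v
  fits = addable⇒fits P i len addb
  below : rowLen (add P i v) (suc i) ≤ y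
  below = ≤-trans (≤-reflexive (trans (rowLen-add-≢ P v (1+n≢n ∘ sym)) (len (suc i)))) ≤y
... | no i≢x | yes (refl , bump) = x , suc x , 1 , bumped (refl , bump) , ≤-refl ,
  down
    (subst (λ y → at2 (add P i v) i y ≡ just v) (trans (len i) fi≡) (at2-add-new P i v fits))
    (λ er → contradiction (trans (sym er) (≥⇒at2-nothing (add P i v) x
      (≤-reflexive (trans (rowLen-add-≢ P v i≢x) (trans (len x) fx≡))))) λ ())
    (subst (λ V → Slide 0 T′ i y V i)
      (remove2-slid-up P x v ne (trans (len x) fx≡) (trans (len i) fi≡))
      (halt
        (≥⇒at2-nothing T′ i (≤-reflexive (begin
          rowLen T′ i            ≡⟨ rowLen-set2 (add P i v) x y v i ⟩
          rowLen (add P i v) i   ≡⟨ rowLen-add-≡ P i v fits ⟩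
          suc (rowLen P i)       ≡⟨ cong suc (trans (len i) fi≡) ⟩
          suc y                  ∎)))
        (≥⇒at2-nothing T′ (suc i) (≤-trans (≤-reflexive (begin
          rowLen T′ (suc i)          ≡⟨ rowLen-set2 (add P i v) x y v (suc i) ⟩
          rowLen (add P i v) (suc i) ≡⟨ rowLen-add-≢ P v (1+n≢n ∘ sym) ⟩
          rowLen P (suc i)           ≡⟨ len (suc i) ⟩
          f (suc i)                  ∎)) (≤-trans (yng i) ≤y)))))
  where
  open ≡-Reasoning
  T′ = set2 (add P i v) x y v
  fits = addable⇒fits P i len addb
  fi≡ : f i ≡ y
  fi≡ = suc-injective (trans (sym bump) fx≡)
... | no i≢x | no ¬bump = i , x , 0 , kept ¬bump , z≤n ,
  subst (λ V → Slide 0 (add P i v) x y V x) (remove2-add-other P i v x i≢x y< long)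
    (halt (≥⇒at2-nothing (add P i v) x
            (≤-reflexive (trans (rowLen-add-≢ P v i≢x) (trans (len x) fx≡))))
          (≥⇒at2-nothing (add P i v) (suc x) below))
  where
  y< : y < rowLen P x
  y< = ≤-reflexive (sym (trans (len x) fx≡))
  fi≢y : suc x ≡ i → f i ≢ y
  fi≢y sx≡i fi≡y = ¬bump (sx≡i , trans fx≡ (cong suc (sym fi≡y)))
  below : rowLen (add P i v) (suc x) ≤ y
  below with i ≟ suc x
  ... | yes refl = ≤-trans
    (≤-reflexive (trans (rowLen-add-≡ P i v (addable⇒fits P i len addb)) (cong suc (len i))))
    (≤∧≢⇒< ≤y (fi≢y refl))
  ... | no i≢sx  = ≤-trans (≤-reflexive (trans (rowLen-add-≢ P v i≢sx) (len (suc x)))) ≤y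
  -- If `y` were 0, row `suc x` would be empty, so the only addable row below `x` would be `suc x`,
  -- and there the maximum would bump.
  0<y : ∀ i → Addable f i → x < i → (suc x ≡ i → f i ≢ y) → 0 < y
  0<y (suc p) fp< x<i fi≢y with suc x ≟ suc p
  ... | yes refl = ≤-trans (s≤s z≤n) (≤∧≢⇒< ≤y (fi≢y refl))
  ... | no sx≢   = ≤-trans (≤-trans (s≤s z≤n) fp<)
    (≤-trans (young⇒antitone yng (s≤s⁻¹ (≤∧≢⇒< x<i sx≢))) ≤y)
  long : x < i → 1 < rowLen P x
  long x<i = ≤-trans (s≤s (0<y i addb x<i fi≢y)) y<

-- As long as the hole has a neighbour in `P`, the maximum loses every comparison, so both paths
-- agree until the shorter one halts. Then `stop-add` contributes at most one more move.
slide-add : ∀ {f i v k U q} P x y → Young f → Addable f i →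
            (∀ z → rowLen P z ≡ f z) → AllRows NonEmpty P → All² (_< v) P → y < f x →
            Slide k P x y U q →
            ∃[ i′ ] ∃[ q′ ] ∃[ k′ ] (Outcome f i q i′ q′ × k′ ≤ suc k ×
                                     Slide k′ (add P i v) x y (add U i′ v) q′)
slide-add {f} P x y yng addb len ne <v y< (halt er eb) = stop-add P x y yng addb len ne
  (≤-antisym (≤-trans (≤-reflexive (sym (len x))) (at2-nothing⇒≥ P x er)) y<)
  (≤-trans (≤-reflexive (sym (len (suc x)))) (at2-nothing⇒≥ P (suc x) eb))
slide-add {f} {i} {v} P x y yng addb len ne <v y< (right {u = u} er u< s)
  with i′ , q′ , k′ , o , k′≤ , s′ ←
    slide-add (set2 P x y u) x (suc y) yng addb
      (λ z → trans (rowLen-set2 P x y u z) (len z)) (nonEmpty-set2 P x y u ne)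
      (set2-All² x y <v (at2-All² x <v er)) (subst (suc y <_) (len x) (at2-just⇒< P er)) s =
  i′ , q′ , suc k′ , o , s≤s k′≤ ,
  right (trans (at2-add-old P i v x (at2-just⇒< P er)) er)
        (λ eb → u<′ (at2-add⁻ P i v (suc x) y eb))
        (subst (λ T → Slide k′ T x (suc y) _ q′) (sym (set2-add P i v x u (subst (y <_) (sym (len x)) y<))) s′)
  where
  u<′ : ∀ {b} → at2 P (suc x) y ≡ just b ⊎ b ≡ v → u < b
  u<′ (inj₁ eb)   = u< eb
  u<′ (inj₂ refl) = at2-All² x <v er
slide-add {f} {i} {v} P x y yng addb len ne <v y< (down {u = u} eb u≤ s)
  with i′ , q′ , k′ , o , k′≤ , s′ ←
    slide-add (set2 P x y u) (suc x) y yng addb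
      (λ z → trans (rowLen-set2 P x y u z) (len z)) (nonEmpty-set2 P x y u ne)
      (set2-All² x y <v (at2-All² (suc x) <v eb)) (subst (y <_) (len (suc x)) (at2-just⇒< P eb)) s =
  i′ , q′ , suc k′ , o , s≤s k′≤ ,
  down (trans (at2-add-old P i v (suc x) (at2-just⇒< P eb)) eb)
       (λ er → u≤′ (at2-add⁻ P i v x (suc y) er))
       (subst (λ T → Slide k′ T (suc x) y _ q′) (sym (set2-add P i v x u (subst (y <_) (sym (len x)) y<))) s′)
  where
  u≤′ : ∀ {b} → at2 P x (suc y) ≡ just b ⊎ b ≡ v → u ≤ b
  u≤′ (inj₁ er)   = u≤ er
  u≤′ (inj₂ refl) = <⇒≤ (at2-All² (suc x) <v eb)

-- Locating entries

==-refl : ∀ m → (m == m) ≡ true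
==-refl zero    = refl
==-refl (suc m) = ==-refl m

≢⇒== : ∀ {m n} → m ≢ n → (m == n) ≡ false
≢⇒== {zero}  {zero}  m≢n = contradiction refl m≢n
≢⇒== {zero}  {suc n} m≢n = refl
≢⇒== {suc m} {zero}  m≢n = refl
≢⇒== {suc m} {suc n} m≢n = ≢⇒== (m≢n ∘ cong suc)

findRow-absent : ∀ {v r} → All (_< v) r → findRow v r ≡ nothing
findRow-absent []         = refl
findRow-absent (x<v ∷ <v) rewrite ≢⇒== (<⇒≢ x<v ∘ sym) | findRow-absent <v = refl

findRow-∷ʳ-new : ∀ {v} r → All (_< v) r → findRow v (r ∷ʳ v) ≡ just (length r)
findRow-∷ʳ-new {v} []      []         rewrite ==-refl v = refl
findRow-∷ʳ-new     (x ∷ r) (x<v ∷ <v) rewrite ≢⇒== (<⇒≢ x<v ∘ sym) | findRow-∷ʳ-new r <v = refl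

findRow-∷ʳ-just : ∀ m r v {j} → findRow m r ≡ just j → findRow m (r ∷ʳ v) ≡ just j
findRow-∷ʳ-just m (x ∷ r) v eq with m == x
... | true = eq
... | false with findRow m r in eqr
...   | just j rewrite findRow-∷ʳ-just m r v eqr = eq

findRow-∷ʳ-nothing : ∀ m r v → m ≢ v → findRow m r ≡ nothing → findRow m (r ∷ʳ v) ≡ nothing
findRow-∷ʳ-nothing m []      v m≢v eq rewrite ≢⇒== m≢v = refl
findRow-∷ʳ-nothing m (x ∷ r) v m≢v eq with m == x
... | false with findRow m r in eqr
...   | nothing rewrite findRow-∷ʳ-nothing m r v m≢v eqr = refl

find2-add-old : ∀ m T i v {p} → m ≢ v → find2 m T ≡ just p → find2 m (add T i v) ≡ just p
find2-add-old m (r ∷ T) zero v m≢v eq with findRow m r in eqr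
... | just j  rewrite findRow-∷ʳ-just m r v eqr = eq
... | nothing rewrite findRow-∷ʳ-nothing m r v m≢v eqr = eq
find2-add-old m (r ∷ T) (suc i) v m≢v eq with findRow m r
... | just j = eq
... | nothing with find2 m T in eqT
...   | just p rewrite find2-add-old m T i v m≢v eqT = eq

find2-add-new : ∀ T i v → All² (_< v) T → i ≤ length T → find2 v (add T i v) ≡ just (i , rowLen T i)
find2-add-new []      zero    v _         _  rewrite ==-refl v = refl
find2-add-new (r ∷ T) zero    v (<v ∷ _)  _  rewrite findRow-∷ʳ-new r <v = refl
find2-add-new (r ∷ T) (suc i) v (<v ∷ <T) i≤
  rewrite findRow-absent <v | find2-add-new T i v <T (s≤s⁻¹ i≤) = refl

-- Jeu de taquin on decoded tableaux

rowLen-≤-add : ∀ T i v x → i ≤ length T → rowLen T x ≤ rowLen (add T i v) x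
rowLen-≤-add T i v x i≤ with i ≟ x
... | yes refl = ≤-trans (n≤1+n _) (≤-reflexive (sym (rowLen-add-≡ T i v i≤)))
... | no i≢x   = ≤-reflexive (sym (rowLen-add-≢ T v i≢x))

addable-cong : ∀ {f g} i → (∀ x → f x ≡ g x) → Addable f i → Addable g i
addable-cong zero    f≡g _   = tt
addable-cong (suc i) f≡g add = subst₂ _<_ (f≡g (suc i)) (f≡g i) add

rowLen-decode : ∀ w → Lattice w → ∀ x → rowLen (decode w) x ≡ count w x
decode-fits   : ∀ i w → Lattice (i ∷ w) → i ≤ length (decode w)
rowLen-decode []      _   x = refl
rowLen-decode (i ∷ w) lat x with i ≟ x
... | yes refl = trans (rowLen-add-≡ (decode w) i _ (decode-fits i w lat))
                       (trans (cong suc (rowLen-decode w (proj₂ lat) i)) (sym (count-≡ i w)))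
... | no i≢x   = trans (rowLen-add-≢ (decode w) _ i≢x)
                       (trans (rowLen-decode w (proj₂ lat) x) (sym (count-≢ w i≢x)))
decode-fits i w (addi , lat) = addable⇒fits (decode w) i (rowLen-decode w lat) addi

decode-nonEmpty : ∀ w → AllRows NonEmpty (decode w)
decode-nonEmpty []      = tt
decode-nonEmpty (i ∷ w) = nonEmpty-add (decode w) i _ (decode-nonEmpty w)

decode-< : ∀ w → All² (_< suc (length w)) (decode w)
decode-< []      = []
decode-< (i ∷ w) = add-All² i (All.map (All.map m<n⇒m<1+n) (decode-< w)) ≤-refl

size-decode : ∀ w → Lattice w → size (decode w) ≡ length w
size-decode []      _   = refl
size-decode (i ∷ w) lat = trans (size-add (decode w) i _ (decode-fits i w lat)) (cong suc (size-decode w (proj₂ lat)))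

decr-≤ : ∀ {m x} → x ≤ m → decr m x ≡ x
decr-≤ {m} {x} x≤m rewrite dec-false (m <? x) (≤⇒≯ x≤m) = refl

decr-> : ∀ {m x} → m < x → decr m x ≡ x ∸ 1
decr-> {m} {x} m<x rewrite dec-true (m <? x) m<x = refl

map²-id : ∀ (g : ℕ → ℕ) {T} → All² (λ x → g x ≡ x) T → map (map g) T ≡ T
map²-id g []       = refl
map²-id g (p ∷ ps) = cong₂ _∷_ (row p) (map²-id g ps)
  where
  row : ∀ {r} → All (λ x → g x ≡ x) r → map g r ≡ r
  row []       = refl
  row (p ∷ ps) = cong₂ _∷_ p (row ps)

outcome⇒push : ∀ w {i q i′ q′} v → Outcome (count w) i q i′ q′ → push w i (v , q) ≡ (i′ ∷ v , q′)
outcome⇒push w v (bumped b) = push-bump w b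
outcome⇒push w v (kept ¬b)  = push-no-bump w ¬b

-- Induction on the number `k` of entries larger than `m`. For `k = 0` the hole starts in a corner;
-- each larger entry is then put back by `slide-add`, whose outcome is one `push`.
slide-decode : ∀ w k m → Lattice w → k + m ≡ length w → 0 < m →
  ∃[ x ] ∃[ y ] ∃[ n ] ∃[ U ] (find2 m (decode w) ≡ just (x , y) × y < rowLen (decode w) x × n ≤ k ×
    Slide n (decode w) x y U (proj₂ (delete w k)) × map (map (decr m)) U ≡ decode (proj₁ (delete w k)))
slide-decode [] zero m _ refl ()
slide-decode (i ∷ w) zero m lat@(_ , latw) refl _ =
  i , rowLen P i , 0 , remove2 (add P i m) i (rowLen P i) ,
  find2-add-new P i m (decode-< w) fits ,
  ≤-reflexive (sym (rowLen-add-≡ P i m fits)) , z≤n ,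
  halt (≥⇒at2-nothing (add P i m) i (≤-reflexive (rowLen-add-≡ P i m fits)))
       (≥⇒at2-nothing (add P i m) (suc i) (begin
         rowLen (add P i m) (suc i) ≡⟨ rowLen-add-≢ P m (1+n≢n ∘ sym) ⟩
         rowLen P (suc i)           ≡⟨ rowLen-decode w latw (suc i) ⟩
         count w (suc i)            ≤⟨ lattice⇒young w latw i ⟩
         count w i                  ≡⟨ sym (rowLen-decode w latw i) ⟩
         rowLen P i                 ∎)) ,
  trans (cong (map (map (decr m))) (remove2-add-new P i m (decode-nonEmpty w) fits))
        (map²-id (decr m) (All.map (All.map (decr-≤ ∘ <⇒≤)) (decode-< w)))
  where
  open ≤-Reasoning
  P = decode w
  fits = decode-fits i w lat
slide-decode (i ∷ w) (suc k) m lat@(addi , latw) eq 0<m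
  with x , y , n , U , found , y< , n≤k , s , U≡ ← slide-decode w k m latw (suc-injective eq) 0<m
  with i′ , q′ , n′ , o , n′≤ , s′ ← slide-add (decode w) x y (lattice⇒young w latw) addi
         (rowLen-decode w latw) (decode-nonEmpty w) (decode-< w) (subst (y <_) (rowLen-decode w latw x) y<) s =
  x , y , n′ , add U i′ N ,
  find2-add-old m (decode w) i N (<⇒≢ m<N) found ,
  ≤-trans y< (rowLen-≤-add (decode w) i N x (decode-fits i w lat)) ,
  ≤-trans n′≤ (s≤s n≤k) ,
  subst (Slide n′ (decode (i ∷ w)) x y (add U i′ N)) (cong proj₂ (sym p≡)) s′ ,
  (begin
    map (map (decr m)) (add U i′ N)               ≡⟨ map-add (decr m) U i′ N ⟩
    add (map (map (decr m)) U) i′ (decr m N)      ≡⟨ cong₂ (λ T → add T i′) U≡ (decr-> m<N) ⟩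
    -- The decremented maximum is the label that `decode` gives to the head, because `v` is one
    -- letter shorter than `w`.
    add (decode v) i′ (length w)                  ≡⟨ cong (add (decode v) i′) (sym (delete-length w k<)) ⟩
    decode (i′ ∷ v)                               ≡⟨ cong (decode ∘ proj₁) (sym p≡) ⟩
    decode (proj₁ (push w i (delete w k)))        ∎)
  where
  open ≡-Reasoning
  N = suc (length w)
  v = proj₁ (delete w k)
  m<N : m < N
  m<N = s≤s (≤-trans (m≤n+m m k) (≤-reflexive (suc-injective eq)))
  k< : k < length w
  k< = ≤-trans (m<m+n k 0<m) (≤-reflexive (suc-injective eq))
  p≡ : push w i (delete w k) ≡ (i′ ∷ v , q′)
  p≡ = outcome⇒push w v o

del-decode : ∀ w k m → Lattice w → k + m ≡ length w → 0 < m →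
             del (decode w) m ≡ decode (proj₁ (delete w k))
del-decode w k m lat eq 0<m with x , y , n , U , found , _ , n≤k , s , U≡ ← slide-decode w k m lat eq 0<m
  rewrite found = trans (cong (map (map (decr m))) (slide-Slide s n≤)) U≡
  where
  -- The path has at most `k` moves, well within the fuel supplied by `del`.
  n≤ : n ≤ suc (size (decode w))
  n≤ = m≤n⇒m≤1+n (≤-trans n≤k (≤-trans (m≤m+n k m) (≤-reflexive (trans eq (sym (size-decode w lat))))))

-- Every tableau is decoded from a word

rowInc-≤ : ∀ {v} x r → RowInc (x ∷ r) → All (_≤ v) r → v ∈ x ∷ r → ∃[ r′ ] x ∷ r ≡ r′ ∷ʳ v
rowInc-≤ x []      _        _            (here refl) = [] , refl
rowInc-≤ x (y ∷ r) (x<y , _) (y≤v ∷ _)   (here refl) = contradiction x<y (≤⇒≯ y≤v)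
rowInc-≤ x (y ∷ r) (_ , inc) (_ ∷ ≤v)    (there v∈) with r′ , eq ← rowInc-≤ y r inc ≤v v∈ =
  x ∷ r′ , cong (x ∷_) eq

rowInc-∷ʳ⁻ : ∀ r {v} → RowInc (r ∷ʳ v) → RowInc r
rowInc-∷ʳ⁻ []          _           = tt
rowInc-∷ʳ⁻ (x ∷ [])    _           = tt
rowInc-∷ʳ⁻ (x ∷ y ∷ r) (x<y , inc) = x<y , rowInc-∷ʳ⁻ (y ∷ r) inc

-- No entry of `s` can lie under the dropped `v`, since it would have to exceed `v`.
colInc-∷ʳ⁻ˡ : ∀ r s {v} → All (_≤ v) s → ColInc (r ∷ʳ v) s → ColInc r s
colInc-∷ʳ⁻ˡ r       []      _          _         = tt
colInc-∷ʳ⁻ˡ []      (y ∷ s) (y≤v ∷ _)  (v<y , _) = contradiction v<y (≤⇒≯ y≤v)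
colInc-∷ʳ⁻ˡ (x ∷ r) (y ∷ s) (_ ∷ ≤v)   (x<y , c) = x<y , colInc-∷ʳ⁻ˡ r s ≤v c

colInc-∷ʳ⁻ʳ : ∀ r s {v} → ColInc r (s ∷ʳ v) → ColInc r s
colInc-∷ʳ⁻ʳ r       []      _         = tt
colInc-∷ʳ⁻ʳ (x ∷ r) (y ∷ s) (x<y , c) = x<y , colInc-∷ʳ⁻ʳ r s c

colInc⇒≤ : ∀ r s → ColInc r s → length s ≤ length r
colInc⇒≤ r       []      _       = z≤n
colInc⇒≤ (x ∷ r) (y ∷ s) (_ , c) = s≤s (colInc⇒≤ r s c)

colsInc⇒young : ∀ T → ColsInc T → Young (rowLen T)
colsInc⇒young []          _       x       = z≤n
colsInc⇒young (r ∷ [])    _       zero    = z≤n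
colsInc⇒young (r ∷ [])    _       (suc x) = z≤n
colsInc⇒young (r ∷ s ∷ T) (c , _) zero    = colInc⇒≤ r s c
colsInc⇒young (r ∷ s ∷ T) (_ , c) (suc x) = colsInc⇒young (s ∷ T) c x

colsInc-add⁻ : ∀ r T i {v} → ColsInc (r ∷ add T i v) → ColsInc T → ColsInc (r ∷ T)
colsInc-add⁻ r []      i       _       _  = tt
colsInc-add⁻ r (s ∷ T) zero    (c , _) cs = colInc-∷ʳ⁻ʳ r s c , cs
colsInc-add⁻ r (s ∷ T) (suc i) (c , _) cs = c , cs

colsInc-tail : ∀ r T → ColsInc (r ∷ T) → ColsInc T
colsInc-tail r []      _       = tt
colsInc-tail r (s ∷ T) (_ , c) = c

Increasing : Tableau → Set
Increasing T = AllRows NonEmpty T × AllRows RowInc T × ColsInc T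

-- The maximum ends its row and has nothing below it, so dropping it leaves a tableau. If it is
-- alone in its row, that row is the last one and disappears; `add` opens it again.
extract-max : ∀ {v} T → Increasing T → All² (_≤ v) T → v ∈ concat T →
              ∃[ P ] ∃[ i ] (T ≡ add P i v × i ≤ length P × Increasing P × v ∷ concat P ↭ concat T)
extract-max {v} (r@(_ ∷ _) ∷ T) ((_ , ne) , (inc , incs) , cols) (≤v@(_ ∷ ≤v′) ∷ ≤T) v∈ with ∈-++⁻ r v∈
... | inj₁ v∈r with rowInc-≤ _ _ inc ≤v′ v∈r
...   | r′@(_ ∷ _) , refl = r′ ∷ T , 0 , refl , z≤n ,
  ((tt , ne) , (rowInc-∷ʳ⁻ r′ inc , incs) , heads T ≤T cols) ,
  ↭-trans (↭-sym (shift v r′ (concat T))) (↭-reflexive (sym (++-assoc r′ (v ∷ []) (concat T))))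
  where
  heads : ∀ T → All² (_≤ v) T → ColsInc ((r′ ∷ʳ v) ∷ T) → ColsInc (r′ ∷ T)
  heads []      _          _        = tt
  heads (s ∷ T) (≤s ∷ _) (c , cs) = colInc-∷ʳ⁻ˡ r′ s ≤s c , cs
extract-max ((v ∷ []) ∷ []) _ _ _ | inj₁ _ | [] , refl = [] , 0 , refl , z≤n , (tt , tt , tt) , ↭-refl
extract-max ((v ∷ []) ∷ (y ∷ s) ∷ T) (_ , _ , (v<y , _) , _) (_ ∷ (y≤v ∷ _) ∷ _) _ | inj₁ _ | [] , refl =
  contradiction v<y (≤⇒≯ y≤v)
extract-max {v} (r ∷ T) ((ner , ne) , (inc , incs) , cols) (_ ∷ ≤T) _ | inj₂ v∈T
  with P , i , refl , i≤ , (neP , incP , colsP) , perm ←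
    extract-max T (ne , incs , colsInc-tail r T cols) ≤T v∈T =
  r ∷ P , suc i , refl , s≤s i≤ , ((ner , neP) , (inc , incP) , colsInc-add⁻ r P i cols colsP) ,
  ↭-trans (↭-sym (shift v r (concat P))) (++⁺ˡ r perm)

add-young⇒addable : ∀ T i v → i ≤ length T → Young (rowLen (add T i v)) → Addable (rowLen T) i
add-young⇒addable T zero    v _  _   = tt
add-young⇒addable T (suc i) v i≤ yng =
  subst₂ _≤_ (rowLen-add-≡ T (suc i) v i≤) (rowLen-add-≢ T v 1+n≢n) (yng i)

oneTo-suc : ∀ n → map suc (upTo (suc n)) ↭ suc n ∷ map suc (upTo n)
oneTo-suc n = ↭-trans
  (↭-reflexive (trans (cong (map suc) (sym (upTo-∷ʳ n))) (map-++ suc (upTo n) (n ∷ []))))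
  (↭-sym (∷↭∷ʳ (suc n) (map suc (upTo n))))

encode : ∀ n T → YT n T → ∃[ w ] (Lattice w × length w ≡ n × decode w ≡ T)
encode zero    []            _                          = [] , tt , refl , refl
encode zero    ((_ ∷ _) ∷ T) (_ , _ , _ , perm) with () ← ↭-empty-inv perm
encode (suc n) T (ne , inc , cols , perm)
  with P , i , refl , i≤ , (neP , incP , colsP) , perm′ ← extract-max T (ne , inc , cols)
         (All.concat⁻ (All-resp-↭ (↭-sym perm) (All.map⁺ (All.tabulate ∈-upTo⁻))))
         (∈-resp-↭ (↭-sym perm) (∈-map⁺ suc (∈-upTo⁺ ≤-refl)))
  with w , lat , refl , refl ← encode n P (neP , incP , colsP , drop-∷ (↭-trans perm′ (↭-trans perm (oneTo-suc n)))) =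
  i ∷ w ,
  (addable-cong i (rowLen-decode w lat)
    (add-young⇒addable P i (suc n) i≤ (colsInc⇒young (add P i (suc n)) cols)) , lat) ,
  refl , refl

-- Injectivity of `decode` and the transfer of 2-minors

decode-tail : ∀ i v j w → Lattice (i ∷ v) → Lattice (j ∷ w) → length v ≡ length w →
              decode (i ∷ v) ≡ decode (j ∷ w) → decode v ≡ decode w
decode-tail i v j w latv latw leq eq = begin
  decode v                              ≡⟨ sym (del-decode (i ∷ v) 0 (suc (length v)) latv refl z<s) ⟩
  del (decode (i ∷ v)) (suc (length v)) ≡⟨ cong₂ del eq (cong suc leq) ⟩
  del (decode (j ∷ w)) (suc (length w)) ≡⟨ del-decode (j ∷ w) 0 (suc (length w)) latw refl z<s ⟩
  decode w                              ∎
  where open ≡-Reasoning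

-- Deleting the maximum from both tableaux reduces to the tails; once these agree, the row lengths
-- reveal the head.
decode-injective : ∀ v w → Lattice v → Lattice w → length v ≡ length w → decode v ≡ decode w → v ≡ w
decode-injective []      []      _    _    _   _  = refl
decode-injective (i ∷ v) (j ∷ w) latv latw leq eq
  with refl ← decode-injective v w (proj₂ latv) (proj₂ latw) (suc-injective leq)
                (decode-tail i v j w latv latw (suc-injective leq) eq) = cong (_∷ v) i≡j
  where
  open ≡-Reasoning
  i≡j : i ≡ j
  i≡j with i ≟ j
  ... | yes i≡j = i≡j
  ... | no i≢j = contradiction (begin
    suc (count v i)          ≡⟨ sym (count-≡ i v) ⟩
    count (i ∷ v) i          ≡⟨ sym (rowLen-decode (i ∷ v) latv i) ⟩
    rowLen (decode (i ∷ v)) i ≡⟨ cong (λ T → rowLen T i) eq ⟩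
    rowLen (decode (j ∷ v)) i ≡⟨ rowLen-decode (j ∷ v) latw i ⟩
    count (j ∷ v) i          ≡⟨ count-≢ v (i≢j ∘ sym) ⟩
    count v i                ∎) 1+n≢n

M₂⇒minors₂ : ∀ w U → Lattice w → M₂ (length w) (decode w) U → ∃[ u ] (u ∈ minors₂ w × U ≡ decode u)
M₂⇒minors₂ w U lat (a , b , 1≤a , a≤n , 1≤b , b≤n-1 , refl) =
  proj₁ (delete v l) ,
  ∈-minors₂⁺ w (∈-minors⁺ w k<) (∈-minors⁺ v (∸-monoʳ-< 1≤b b≤)) ,
  trans (cong (λ T → del T b) (del-decode w k a lat (m∸n+n≡m a≤n) 1≤a))
        (del-decode v l b (delete-lattice w lat k<) (m∸n+n≡m b≤) 1≤b)
  where
  -- Words list the largest entry first, so the entry `a` has position `length w ∸ a`; likewise for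
  -- `b` in `v`.
  k = length w ∸ a
  k< : k < length w
  k< = ∸-monoʳ-< 1≤a a≤n
  v = proj₁ (delete w k)
  b≤ : b ≤ length v
  b≤ = ≤-trans b≤n-1 (≤-reflexive (cong (_∸ 1) (sym (delete-length w k<))))
  l = length v ∸ b

minors₂⇒M₂ : ∀ w u → Lattice w → u ∈ minors₂ w → M₂ (length w) (decode w) (decode u)
minors₂⇒M₂ w u lat u∈
  with v , v∈ , u∈v ← ∈-minors₂⁻ w u∈
  with k , k< , refl ← ∈-minors⁻ w v∈
  with l , l< , refl ← ∈-minors⁻ (proj₁ (delete w k)) u∈v =
  length w ∸ k , length v ∸ l , m<n⇒0<n∸m k< , m∸n≤m (length w) k , m<n⇒0<n∸m l< ,
  ≤-trans (m∸n≤m (length v) l) (≤-reflexive (cong (_∸ 1) (delete-length w k<))) ,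
  sym (trans
    (cong (λ T → del T (length v ∸ l))
      (del-decode w k (length w ∸ k) lat (m+[n∸m]≡n (<⇒≤ k<)) (m<n⇒0<n∸m k<)))
    (del-decode v l (length v ∸ l) (delete-lattice w lat k<) (m+[n∸m]≡n (<⇒≤ l<)) (m<n⇒0<n∸m l<)))

minors-lattice : ∀ w {v} → Lattice w → v ∈ minors w → Lattice v × suc (length v) ≡ length w
minors-lattice w lat v∈ with k , k< , refl ← ∈-minors⁻ w v∈ = delete-lattice w lat k< , delete-length w k<

minors₂-lattice : ∀ w {u} → Lattice w → u ∈ minors₂ w → Lattice u × suc (suc (length u)) ≡ length w
minors₂-lattice w lat u∈
  with v , v∈ , u∈v ← ∈-minors₂⁻ w u∈
  with latv , lv ← minors-lattice w lat v∈
  with latu , lu ← minors-lattice v latv u∈v = latu , trans (cong suc lu) lv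

-- A 2-minor is decoded, carried over as a tableau, and recognised again as a word by
-- `decode-injective`; the lengths agree as each is two less than the common length.
M₂⊆⇒⊑ : ∀ v w → Lattice v → Lattice w → length v ≡ length w →
        (∀ U → M₂ (length v) (decode v) U → M₂ (length w) (decode w) U) → v ⊑ w
M₂⊆⇒⊑ v w latv latw leq M⊆ u u∈
  with u′ , u′∈ , eq ← M₂⇒minors₂ w (decode u) latw (M⊆ (decode u) (minors₂⇒M₂ v u latv u∈))
  with latu , lu ← minors₂-lattice v latv u∈
  with latu′ , lu′ ← minors₂-lattice w latw u′∈ =
  subst (_∈ minors₂ w) (sym (decode-injective u u′ latu latu′ same-length eq)) u′∈
  where
  same-length : length u ≡ length u′
  same-length = suc-injective (suc-injective (trans lu (trans leq (sym lu′))))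

theorem6p1 : (n : ℕ) → 8 ≤ n → (S T : Tableau) → YT n S → YT n T
    → ((U : Tableau) → M₂ n S U ⇔ M₂ n T U) → S ≡ T
theorem6p1 n 8≤n S T ytS ytT same
  with s , lats , refl , refl ← encode n S ytS
  with t , latt , leq , refl ← encode (length s) T ytT =
  cong decode (reconstructible-+ reconstructible-8 (length s ∸ 8) s t n≡ (trans leq n≡) lats latt
    (M₂⊆⇒⊑ s t lats latt (sym leq) λ U m → subst (λ n → M₂ n (decode t) U) (sym leq) (Equivalence.to (same U) m))
    (M₂⊆⇒⊑ t s latt lats leq λ U m → Equivalence.from (same U) (subst (λ n → M₂ n (decode t) U) leq m)))
  where
  n≡ : length s ≡ length s ∸ 8 + 8
  n≡ = sym (m∸n+n≡m 8≤n)
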